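{- Let $k=k(n)$ satisfy $k\to\infty$ and $k=o(n^{1/3})$ as $n\to\infty$. Then almost all connected graphs with $n$ vertices and $n+k$ edges are triangle-free, i.e. $$\lim_{n\to\infty}\frac{c_{C_3}(n,n+k)}{c(n,n+k)}=1.$$
   Context: $c(n,m)$ is the number of connected simple graphs on vertex set $\{1,\dots,n\}$ with $m$ edges, and $c_{C_3}(n,m)$ is the number of those containing no triangle (3-cycle) as a subgraph. -}

module Defs where

open import Data.Nat using (ℕ; zero; suc; _+_; _*_; _∸_; _^_; _≤_; _<_)
open import Data.Bool using (Bool; true; false)
open import Data.Fin using (Fin)
open import Data.Vec using (Vec; []; _∷_; lookup)
open import Data.Product using (Σ; ∃; _×_; _,_)
open import Data.Empty using (⊥)
open import Relation.Binary.PropositionalEquality using (_≡_)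
open import Function.Definitions using (Injective)

Graph : ℕ → Set
Graph n = Vec (Vec Bool n) n

entry : ∀ {n} → Graph n → Fin n → Fin n → Bool
entry G i j = lookup (lookup G i) j

Adj : ∀ {n} → Graph n → Fin n → Fin n → Set
Adj G i j = entry G i j ≡ true

IsSimple : ∀ {n} → Graph n → Set
IsSimple {n} G = (∀ i → entry G i i ≡ false) × (∀ i j → entry G i j ≡ entry G j i)

countTrue : ∀ {k} → Vec Bool k → ℕ
countTrue [] = 0
countTrue (true ∷ xs) = suc (countTrue xs)
countTrue (false ∷ xs) = countTrue xs

-- number of true entries of the matrix (= twice the number of edges for a simple graph)
trueEntries : ∀ {n k} → Vec (Vec Bool n) k → ℕ
trueEntries [] = 0
trueEntries (r ∷ rs) = countTrue r + trueEntries rs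

HasEdges : ∀ {n} → Graph n → ℕ → Set
HasEdges G m = trueEntries G ≡ 2 * m

data Walk {n} (G : Graph n) : Fin n → Fin n → Set where
  here : ∀ {i} → Walk G i i
  step : ∀ {i j l} → Adj G i j → Walk G j l → Walk G i l

Connected : ∀ {n} → Graph n → Set
Connected G = ∀ i j → Walk G i j

TriangleFree : ∀ {n} → Graph n → Set
TriangleFree G = ∀ a b c → Adj G a b → Adj G b c → Adj G c a → ⊥

Counts : ∀ {n} → (Graph n → Set) → ℕ → Set
Counts {n} P N = Σ (Fin N → Graph n) λ f →
  Injective _≡_ _≡_ f × (∀ i → P (f i)) × (∀ G → P G → ∃ λ i → f i ≡ G)

IsC : (ℕ → ℕ → ℕ) → Set
IsC c = ∀ n m → Counts {n} (λ G → IsSimple G × HasEdges G m × Connected G) (c n m)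

IsCC3 : (ℕ → ℕ → ℕ) → Set
IsCC3 c = ∀ n m → Counts {n} (λ G → IsSimple G × HasEdges G m × Connected G × TriangleFree G) (c n m)

Eventually : (ℕ → Set) → Set
Eventually P = ∃ λ N → ∀ n → N ≤ n → P n

{-# OPTIONS --safe #-}

-- Let H range over the connected graphs with n vertices and n + k edges, let N be their number and let s be
-- the order of the 2-core of H.  Any vertex set of size t spans at most t + k edges.
--
-- (1) Let abc be a triangle.  Either deleting ab and bc leaves a connected graph, or for every vertex z one of
--     b, c can be cut off from the other two triangle vertices and attached to z instead.  The result has one
--     or two edges fewer and O(n²) preimages, so the number T of pairs (H, triangle) is O(n N₁), where N₁ counts
--     the connected graphs with n + k − 1 edges.
-- (2) Adding any of the about n²/2 missing edges to such a graph creates an edge inside the 2-core, so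
--     n² N₁ = O(Σ (s + k)).  Hence n T = O(Σ (s + k)), and in particular T = O(N).
-- (3) A core vertex c with exactly two core neighbours x, y, which are not adjacent, can be replaced by the edge
--     xy while c, together with the tree hanging off it, is attached to a vertex z outside that tree.  There are
--     about s n such moves from H, and at most (n − s)(s + k) moves lead to a given graph.  The terms Σ s n
--     cancel, which leaves Σ s² = O(k n N).
--
-- By (3), Σ s = o(n N), so (2) gives T = o(N).  Edges are changed by toggling, so a move is undone by repeating it.

module Submission where

open import Defs
open import Data.Nat using (ℕ; zero; suc; _+_; _*_; _∸_; _^_; _≤_; _<_; z≤n; s≤s)
open import Data.Nat.Properties
open import Data.Nat.Tactic.RingSolver using (solve-∀)
open import Data.Bool using (Bool; true; false; not)
import Data.Bool.Properties as Bool
open import Data.Fin using (Fin; zero; suc)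
import Data.Fin.Properties as Fin
open import Data.Fin.Subset using (Subset)
open import Data.Fin.Subset.Properties using (anySubset?)
open import Data.Vec using (Vec; []; _∷_; lookup; tabulate)
import Data.Vec.Properties as Vec
open import Data.List using (List; []; _∷_; length; cartesianProduct; allFin)
import Data.List as List
import Data.List.Properties as List
open import Data.List.Membership.Propositional using (_∈_; _∉_)
open import Data.List.Membership.Propositional.Properties using (∈-allFin; ∈-cartesianProduct⁺)
import Data.List.Membership.DecPropositional as DecMembership
open import Data.List.Relation.Unary.Any using (here; there)
import Data.List.Relation.Unary.All as All
open import Data.List.Relation.Unary.AllPairs using ([]; _∷_)
open import Data.List.Relation.Unary.Unique.Propositional using (Unique)
import Data.List.Relation.Unary.Unique.Propositional.Properties as Unique
open import Data.Product using (∃; _×_; _,_; proj₁; proj₂)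
open import Data.Sum using (_⊎_; inj₁; inj₂; [_,_]′) renaming (swap to ⊎-swap)
open import Data.Unit using (⊤; tt)
open import Data.Empty using (⊥)
open import Function using (_∘_; id; case_of_)
open import Relation.Nullary using (¬_; Dec; yes; no; does; ¬?; _×-dec_; _⊎-dec_; _→-dec_; contradiction)
open import Relation.Nullary.Decidable using (dec-true; dec-false; map′; decidable-stable)
open import Relation.Binary.Construct.Closure.ReflexiveTransitive using (Star; ε; _◅_; _◅◅_; reverse)
open import Relation.Binary.PropositionalEquality using (_≡_; _≢_; refl; sym; trans; cong; cong₂; subst; subst₂; module ≡-Reasoning)

-- Finite sums and indicator functions

∑ : {A : Set} → List A → (A → ℕ) → ℕ
∑ []       f = 0
∑ (x ∷ xs) f = f x + ∑ xs f

-- The list meets every element exactly once, so `⅀` is the sum over the whole type. Instance search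
-- supplies the lists for nested products.
record Enum (A : Set) : Set where
  field
    elems    : List A
    unique   : Unique elems
    complete : ∀ x → x ∈ elems

open Enum {{...}}

instance
  enumFin : ∀ {n} → Enum (Fin n)
  enumFin {n} = record { elems = allFin n ; unique = Unique.allFin⁺ n ; complete = ∈-allFin }

  enum× : {A B : Set} {{_ : Enum A}} {{_ : Enum B}} → Enum (A × B)
  enum× = record
    { elems    = cartesianProduct elems elems
    ; unique   = Unique.cartesianProduct⁺ unique unique
    ; complete = λ (x , y) → ∈-cartesianProduct⁺ (complete x) (complete y)
    }

⅀ : {A : Set} {{_ : Enum A}} → (A → ℕ) → ℕ
⅀ = ∑ elems

module _ {A : Set} where

  ∑-mono : (xs : List A) {f g : A → ℕ} → (∀ x → f x ≤ g x) → ∑ xs f ≤ ∑ xs g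
  ∑-mono []       h = z≤n
  ∑-mono (x ∷ xs) h = +-mono-≤ (h x) (∑-mono xs h)

  ∑-+ : (xs : List A) (f g : A → ℕ) → ∑ xs (λ x → f x + g x) ≡ ∑ xs f + ∑ xs g
  ∑-+ []       f g = refl
  ∑-+ (x ∷ xs) f g rewrite ∑-+ xs f g = interchange (f x) (g x) (∑ xs f) (∑ xs g)
    where
    interchange : ∀ a b c d → a + b + (c + d) ≡ a + c + (b + d)
    interchange = solve-∀

  ∑-*ˡ : (xs : List A) (c : ℕ) (f : A → ℕ) → ∑ xs (λ x → c * f x) ≡ c * ∑ xs f
  ∑-*ˡ []       c f = sym (*-zeroʳ c)
  ∑-*ˡ (x ∷ xs) c f rewrite ∑-*ˡ xs c f = sym (*-distribˡ-+ c (f x) (∑ xs f))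

  ∑-const : (xs : List A) (c : ℕ) → ∑ xs (λ _ → c) ≡ length xs * c
  ∑-const []       c = refl
  ∑-const (x ∷ xs) c = cong (c +_) (∑-const xs c)

∑-swap : {A B : Set} (xs : List A) (ys : List B) (f : A → B → ℕ) →
         ∑ xs (λ x → ∑ ys (f x)) ≡ ∑ ys (λ y → ∑ xs (λ x → f x y))
∑-swap []       ys f = sym (trans (∑-const ys 0) (*-zeroʳ (length ys)))
∑-swap (x ∷ xs) ys f rewrite ∑-swap xs ys f = sym (∑-+ ys (f x) _)

∑-++ : {A : Set} (xs ys : List A) (f : A → ℕ) → ∑ (xs List.++ ys) f ≡ ∑ xs f + ∑ ys f
∑-++ []       ys f = refl
∑-++ (x ∷ xs) ys f rewrite ∑-++ xs ys f = sym (+-assoc (f x) (∑ xs f) (∑ ys f))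

∑-map : {A B : Set} (h : A → B) (xs : List A) (f : B → ℕ) → ∑ (List.map h xs) f ≡ ∑ xs (f ∘ h)
∑-map h []       f = refl
∑-map h (x ∷ xs) f = cong (f (h x) +_) (∑-map h xs f)

∑-× : {A B : Set} (xs : List A) (ys : List B) (f : A × B → ℕ) →
      ∑ (cartesianProduct xs ys) f ≡ ∑ xs (λ x → ∑ ys (λ y → f (x , y)))
∑-× []       ys f = refl
∑-× (x ∷ xs) ys f = trans (∑-++ (List.map (x ,_) ys) _ f) (cong₂ _+_ (∑-map (x ,_) ys f) (∑-× xs ys f))

module _ {A : Set} {{_ : Enum A}} where

  ⅀-mono : {f g : A → ℕ} → (∀ x → f x ≤ g x) → ⅀ f ≤ ⅀ g
  ⅀-mono = ∑-mono elems

  ⅀-cong : {f g : A → ℕ} → (∀ x → f x ≡ g x) → ⅀ f ≡ ⅀ g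
  ⅀-cong h = ≤-antisym (⅀-mono (≤-reflexive ∘ h)) (⅀-mono (≤-reflexive ∘ sym ∘ h))

  ⅀-+ : (f g : A → ℕ) → ⅀ (λ x → f x + g x) ≡ ⅀ f + ⅀ g
  ⅀-+ = ∑-+ elems

  ⅀-*ˡ : (c : ℕ) (f : A → ℕ) → ⅀ (λ x → c * f x) ≡ c * ⅀ f
  ⅀-*ˡ = ∑-*ˡ elems

  ⅀-*ʳ : (f : A → ℕ) (c : ℕ) → ⅀ (λ x → f x * c) ≡ ⅀ f * c
  ⅀-*ʳ f c = trans (⅀-cong (λ x → *-comm (f x) c)) (trans (⅀-*ˡ c f) (*-comm c (⅀ f)))

  ⅀-zero : {f : A → ℕ} → (∀ x → f x ≡ 0) → ⅀ f ≡ 0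
  ⅀-zero h = trans (⅀-cong h) (⅀-*ˡ 0 (λ _ → 0))

⅀-const : ∀ n c → ⅀ (λ (_ : Fin n) → c) ≡ n * c
⅀-const n c = trans (∑-const (allFin n) c) (cong (_* c) (List.length-tabulate {n = n} id))

⅀-bound : ∀ n {f : Fin n → ℕ} c → (∀ i → f i ≤ c) → ⅀ f ≤ n * c
⅀-bound n c h = ≤-trans (⅀-mono h) (≤-reflexive (⅀-const n c))

module _ {A B : Set} {{_ : Enum A}} {{_ : Enum B}} where

  ⅀-swap : (f : A → B → ℕ) → ⅀ (λ x → ⅀ (f x)) ≡ ⅀ (λ y → ⅀ (λ x → f x y))
  ⅀-swap = ∑-swap elems elems

  ⅀-× : (f : A × B → ℕ) → ⅀ f ≡ ⅀ (λ x → ⅀ (λ y → f (x , y)))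
  ⅀-× = ∑-× elems elems

  ⅀-separate : (f : A → ℕ) (g : B → ℕ) → ⅀ (λ x → ⅀ (λ y → f x * g y)) ≡ ⅀ f * ⅀ g
  ⅀-separate f g = trans (⅀-cong (λ x → ⅀-*ˡ (f x) g)) (⅀-*ʳ f (⅀ g))

ι : {P : Set} → Dec P → ℕ
ι (yes _) = 1
ι (no _)  = 0

module _ {P : Set} where

  ι≤1 : (d : Dec P) → ι d ≤ 1
  ι≤1 (yes _) = ≤-refl
  ι≤1 (no _)  = z≤n

  ι-yes : P → (d : Dec P) → ι d ≡ 1
  ι-yes p (yes _) = refl
  ι-yes p (no ¬p) = contradiction p ¬p

  ι-no : ¬ P → (d : Dec P) → ι d ≡ 0
  ι-no ¬p (yes p) = contradiction p ¬p
  ι-no ¬p (no _)  = refl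

  ι-¬ : (d : Dec P) → ι d + ι (¬? d) ≡ 1
  ι-¬ (yes _) = refl
  ι-¬ (no _)  = refl

  ι-≤ : {c : ℕ} → (P → 1 ≤ c) → (d : Dec P) → ι d ≤ c
  ι-≤ h (yes p) = h p
  ι-≤ h (no _)  = z≤n

ι-mono : {P Q : Set} → (P → Q) → (p? : Dec P) (q? : Dec Q) → ι p? ≤ ι q?
ι-mono h p? q? = ι-≤ (λ p → ≤-reflexive (sym (ι-yes (h p) q?))) p?

ι-cong : {P Q : Set} → (P → Q) → (Q → P) → (p? : Dec P) (q? : Dec Q) → ι p? ≡ ι q?
ι-cong h h′ p? q? = ≤-antisym (ι-mono h p? q?) (ι-mono h′ q? p?)

ι-× : {P Q : Set} → (p? : Dec P) (q? : Dec Q) → ι (p? ×-dec q?) ≡ ι p? * ι q?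
ι-× (yes _) (yes _) = refl
ι-× (yes _) (no _)  = refl
ι-× (no _)  q?      = refl

ι-⊎ : {P Q : Set} → ¬ (P × Q) → (p? : Dec P) (q? : Dec Q) → ι (p? ⊎-dec q?) ≡ ι p? + ι q?
ι-⊎ h (yes p) (yes q) = contradiction (p , q) h
ι-⊎ h (yes _) (no _)  = refl
ι-⊎ h (no _)  (yes _) = refl
ι-⊎ h (no _)  (no _)  = refl

ι-disjoint : {P Q R S : Set} → ¬ (P × Q) → ¬ (P × R) → ¬ (Q × R) → (P → S) → (Q → S) → (R → S) →
             (p? : Dec P) (q? : Dec Q) (r? : Dec R) (s? : Dec S) → ι p? + ι q? + ι r? ≤ ι s?
ι-disjoint pq pr qr ps qs rs p? q? r? s? = ≤-trans
  (≤-reflexive (sym (trans (ι-⊎ (λ { (inj₁ p , r) → pr (p , r) ; (inj₂ q , r) → qr (q , r) }) (p? ⊎-dec q?) r?)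
                           (cong (_+ ι r?) (ι-⊎ pq p? q?)))))
  (ι-mono [ [ ps , qs ]′ , rs ]′ ((p? ⊎-dec q?) ⊎-dec r?) s?)

-- Counting by injections

_─_ : {A : Set} {y : A} (ys : List A) → y ∈ ys → List A
(_ ∷ ys) ─ here _  = ys
(x ∷ ys) ─ there i = x ∷ (ys ─ i)

∑-─ : {A : Set} {y : A} (ys : List A) (i : y ∈ ys) (f : A → ℕ) → ∑ ys f ≡ f y + ∑ (ys ─ i) f
∑-─ (_ ∷ ys) (here refl) f = refl
∑-─ {y = y} (x ∷ ys) (there i) f rewrite ∑-─ ys i f = left-comm (f x) (f y) _
  where
  left-comm : ∀ a b c → a + (b + c) ≡ b + (a + c)
  left-comm = solve-∀

∈-─ : {A : Set} {y z : A} (ys : List A) (i : y ∈ ys) → z ≢ y → z ∈ ys → z ∈ (ys ─ i)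
∈-─ (_ ∷ ys) (here refl) z≢y (here eq)  = contradiction eq z≢y
∈-─ (_ ∷ ys) (here refl) z≢y (there j)  = j
∈-─ (_ ∷ ys) (there i)   z≢y (here eq)  = here eq
∈-─ (_ ∷ ys) (there i)   z≢y (there j)  = there (∈-─ ys i z≢y j)

-- The matching is a relation rather than a function, because a partner has to exist only for the
-- elements satisfying `P`.
module _ {A B : Set} {P : A → Set} {Q : B → Set} (P? : ∀ x → Dec (P x)) (Q? : ∀ y → Dec (Q y))
         (R : A → B → Set) (injective : ∀ {x x′ y} → P x → P x′ → R x y → R x′ y → x ≡ x′) where

  -- Induction on `xs`: the partner of the head is struck from `ys`, and injectivity of `R` keeps it
  -- from being the partner of a later element.
  ∑-injection : (xs : List A) (ys : List B) → Unique xs →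
                (∀ {x} → x ∈ xs → P x → ∃ λ y → y ∈ ys × Q y × R x y) →
                ∑ xs (ι ∘ P?) ≤ ∑ ys (ι ∘ Q?)
  ∑-injection []       ys _          h = z≤n
  ∑-injection (x ∷ xs) ys (x∉ ∷ uxs) h with P? x
  ... | no _  = ∑-injection xs ys uxs (h ∘ there)
  ... | yes p with h (here refl) p
  ...   | y , i , q , r rewrite ∑-─ ys i (ι ∘ Q?) | ι-yes q (Q? y) =
    s≤s (∑-injection xs (ys ─ i) uxs h′)
    where
    h′ : ∀ {x′} → x′ ∈ xs → P x′ → ∃ λ y → y ∈ (ys ─ i) × Q y × R x′ y
    h′ x′∈ p′ with h (there x′∈) p′
    ... | y′ , i′ , q′ , r′ =
      y′ , ∈-─ ys i (λ { refl → All.lookup x∉ x′∈ (injective p p′ r r′) }) i′ , q′ , r′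

  -- The tool behind every double count below: a move is recorded together with enough data that its
  -- result determines its source.
  ⅀-injection : {{_ : Enum A}} {{_ : Enum B}} → (∀ {x} → P x → ∃ λ y → Q y × R x y) →
                ⅀ (ι ∘ P?) ≤ ⅀ (ι ∘ Q?)
  ⅀-injection h = ∑-injection elems elems unique
    (λ _ p → let (y , q , r) = h p in y , complete y , q , r)

⅀-≥term : {A : Set} {{_ : Enum A}} (f : A → ℕ) (x : A) → f x ≤ ⅀ f
⅀-≥term f x = subst (f x ≤_) (sym (∑-─ elems (complete x) f)) (m≤m+n (f x) _)

⅀-atMostOne : {A : Set} {{_ : Enum A}} {P : A → Set} (P? : ∀ x → Dec (P x)) →
              (∀ {x y} → P x → P y → x ≡ y) → ⅀ (ι ∘ P?) ≤ 1
⅀-atMostOne P? h = ⅀-injection P? (λ (_ : Fin 1) → yes tt) (λ _ _ → ⊤)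
  (λ p q _ _ → h p q) (λ _ → zero , tt , tt)

⅀-single : ∀ {n} (u : Fin n) → ⅀ (λ i → ι (i Fin.≟ u)) ≡ 1
⅀-single u = ≤-antisym
  (⅀-atMostOne (Fin._≟ u) (λ p q → trans p (sym q)))
  (≤-trans (≤-reflexive (sym (ι-yes refl (u Fin.≟ u)))) (⅀-≥term (λ i → ι (i Fin.≟ u)) u))

⅀-pair : ∀ {n} (u v : Fin n) → ⅀ (λ ((i , j) : Fin n × Fin n) → ι (i Fin.≟ u ×-dec j Fin.≟ v)) ≡ 1
⅀-pair {n} u v = trans (⅀-× {A = Fin n} {B = Fin n} _)
  (trans (⅀-cong (λ i → ⅀-cong (λ j → ι-× (i Fin.≟ u) (j Fin.≟ v))))
  (trans (⅀-separate {A = Fin n} {B = Fin n} _ _) (cong₂ _*_ (⅀-single u) (⅀-single v))))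

-- Graphs and edge toggling

adj? : ∀ {n} (G : Graph n) i j → Dec (Adj G i j)
adj? G i j = entry G i j Bool.≟ true

⅀-suc : ∀ {n} (f : Fin (suc n) → ℕ) → ⅀ f ≡ f zero + ⅀ (f ∘ suc)
⅀-suc {n} f = cong (f zero +_)
  (trans (cong (λ l → ∑ l f) (sym (List.map-tabulate {n = n} id suc))) (∑-map suc (allFin n) f))

countTrue-⅀ : ∀ {k} (v : Vec Bool k) → countTrue v ≡ ⅀ (λ j → ι (lookup v j Bool.≟ true))
countTrue-⅀ []          = refl
countTrue-⅀ (true ∷ v)  = trans (cong suc (countTrue-⅀ v)) (sym (⅀-suc (λ j → ι (lookup (true ∷ v) j Bool.≟ true))))
countTrue-⅀ (false ∷ v) = trans (countTrue-⅀ v) (sym (⅀-suc (λ j → ι (lookup (false ∷ v) j Bool.≟ true))))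

trueEntries-⅀ : ∀ {n k} (rs : Vec (Vec Bool n) k) →
                trueEntries rs ≡ ⅀ (λ i → ⅀ (λ j → ι (lookup (lookup rs i) j Bool.≟ true)))
trueEntries-⅀ []       = refl
trueEntries-⅀ (r ∷ rs) = trans (cong₂ _+_ (countTrue-⅀ r) (trueEntries-⅀ rs))
  (sym (⅀-suc (λ i → ⅀ (λ j → ι (lookup (lookup (r ∷ rs) i) j Bool.≟ true)))))

-- Arcs are ordered adjacent pairs, so this is twice the number of edges of a simple graph. Edges
-- are counted in this doubled form throughout.
arcs : ∀ {n} → Graph n → ℕ
arcs {n} G = ⅀ (λ ((i , j) : Fin n × Fin n) → ι (adj? G i j))

arcs-trueEntries : ∀ {n} (G : Graph n) → arcs G ≡ trueEntries G
arcs-trueEntries G = trans (⅀-× (λ (i , j) → ι (adj? G i j))) (sym (trueEntries-⅀ G))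

graph : ∀ {n} → (Fin n → Fin n → Bool) → Graph n
graph f = tabulate (λ i → tabulate (f i))

entry-graph : ∀ {n} (f : Fin n → Fin n → Bool) i j → entry (graph f) i j ≡ f i j
entry-graph f i j = trans (cong (λ r → lookup r j) (Vec.lookup∘tabulate (λ i → tabulate (f i)) i))
                          (Vec.lookup∘tabulate (f i) j)

entry-ext : ∀ {n} {G G′ : Graph n} → (∀ i j → entry G i j ≡ entry G′ i j) → G ≡ G′
entry-ext {G = G} {G′} h = lookup-ext (λ i → lookup-ext (h i))
  where
  lookup-ext : ∀ {A : Set} {n} {xs ys : Vec A n} → (∀ i → lookup xs i ≡ lookup ys i) → xs ≡ ys
  lookup-ext {xs = xs} {ys} h = trans (sym (Vec.tabulate∘lookup xs))
    (trans (Vec.tabulate-cong h) (Vec.tabulate∘lookup ys))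

Adj-cong : ∀ {n} (G G′ : Graph n) {i j i′ j′} → entry G i j ≡ entry G′ i′ j′ → Adj G i j → Adj G′ i′ j′
Adj-cong G G′ eq a = trans (sym eq) a

record Simple {n} (G : Graph n) : Set where
  constructor simple
  field
    loopless  : ∀ i → entry G i i ≡ false
    symmetric : ∀ i j → entry G i j ≡ entry G j i

open Simple

Adj-sym : ∀ {n} {G : Graph n} → Simple G → ∀ {i j} → Adj G i j → Adj G j i
Adj-sym {G = G} sG {i} {j} = Adj-cong G G (symmetric sG i j)

Adj-irrefl : ∀ {n} {G : Graph n} → Simple G → ∀ {i j} → Adj G i j → i ≢ j
Adj-irrefl sG {i} a refl with trans (sym a) (loopless sG i)
... | ()

SamePair : ∀ {n} → (u v i j : Fin n) → Set
SamePair u v i j = (i ≡ u × j ≡ v) ⊎ (i ≡ v × j ≡ u)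

samePair? : ∀ {n} (u v i j : Fin n) → Dec (SamePair u v i j)
samePair? u v i j = (i Fin.≟ u ×-dec j Fin.≟ v) ⊎-dec (i Fin.≟ v ×-dec j Fin.≟ u)

SamePair-flip : ∀ {n} {u v i j : Fin n} → SamePair u v i j → SamePair u v j i
SamePair-flip (inj₁ (p , q)) = inj₂ (q , p)
SamePair-flip (inj₂ (p , q)) = inj₁ (q , p)

notIf : {P : Set} → Dec P → Bool → Bool
notIf (yes _) b = not b
notIf (no _)  b = b

notIf-yes : {P : Set} → P → (d : Dec P) (b : Bool) → notIf d b ≡ not b
notIf-yes p (yes _) b = refl
notIf-yes p (no ¬p) b = contradiction p ¬p

notIf-no : {P : Set} → ¬ P → (d : Dec P) (b : Bool) → notIf d b ≡ b
notIf-no ¬p (yes p) b = contradiction p ¬p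
notIf-no ¬p (no _)  b = refl

toggle : ∀ {n} → Fin n → Fin n → Graph n → Graph n
toggle u v G = graph (λ i j → notIf (samePair? u v i j) (entry G i j))

module _ {n} {u v : Fin n} (G : Graph n) where

  toggle-on : ∀ {i j} → SamePair u v i j → entry (toggle u v G) i j ≡ not (entry G i j)
  toggle-on {i} {j} p = trans (entry-graph _ i j) (notIf-yes p (samePair? u v i j) _)

  toggle-off : ∀ {i j} → ¬ SamePair u v i j → entry (toggle u v G) i j ≡ entry G i j
  toggle-off {i} {j} ¬p = trans (entry-graph _ i j) (notIf-no ¬p (samePair? u v i j) _)

toggle-involutive : ∀ {n} (u v : Fin n) (G : Graph n) → toggle u v (toggle u v G) ≡ G
toggle-involutive u v G = entry-ext λ i j → case samePair? u v i j of λ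
  { (yes p) → trans (toggle-on (toggle u v G) p)
                    (trans (cong not (toggle-on G p)) (Bool.not-involutive _))
  ; (no ¬p) → trans (toggle-off (toggle u v G) ¬p) (toggle-off G ¬p) }

toggle-injective : ∀ {n} (u v : Fin n) {G G′ : Graph n} → toggle u v G ≡ toggle u v G′ → G ≡ G′
toggle-injective u v {G} {G′} eq =
  trans (sym (toggle-involutive u v G)) (trans (cong (toggle u v) eq) (toggle-involutive u v G′))

toggle-simple : ∀ {n} {u v : Fin n} {G : Graph n} → u ≢ v → Simple G → Simple (toggle u v G)
toggle-simple {u = u} {v} {G} u≢v sG = simple
  (λ i → trans (toggle-off G λ { (inj₁ (refl , eq)) → u≢v eq ; (inj₂ (refl , eq)) → u≢v (sym eq) }) (loopless sG i))
  (λ i j → case samePair? u v i j of λ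
    { (yes p) → trans (toggle-on G p) (trans (cong not (symmetric sG i j)) (sym (toggle-on G (SamePair-flip p))))
    ; (no ¬p) → trans (toggle-off G ¬p) (trans (symmetric sG i j) (sym (toggle-off G (¬p ∘ SamePair-flip)))) })

module _ {n} {G : Graph n} (sG : Simple G) {u v : Fin n} where

  SamePair-Adj : ∀ {i j} → SamePair u v i j → Adj G i j → Adj G u v
  SamePair-Adj (inj₁ (refl , refl)) a = a
  SamePair-Adj (inj₂ (refl , refl)) a = Adj-sym sG a

  remove→ : Adj G u v → ∀ {i j} → Adj (toggle u v G) i j → Adj G i j × ¬ SamePair u v i j
  remove→ uv {i} {j} a with samePair? u v i j
  ... | no ¬p = Adj-cong (toggle u v G) G (toggle-off G ¬p) a , ¬p
  ... | yes (inj₁ (refl , refl)) with trans (sym a) (trans (toggle-on G (inj₁ (refl , refl))) (cong not uv))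
  ...   | ()
  remove→ uv {i} {j} a | yes (inj₂ (refl , refl))
    with trans (sym a) (trans (toggle-on G (inj₂ (refl , refl))) (cong not (Adj-sym sG uv)))
  ... | ()

  remove← : ∀ {i j} → Adj G i j → ¬ SamePair u v i j → Adj (toggle u v G) i j
  remove← a ¬p = Adj-cong G (toggle u v G) (sym (toggle-off G ¬p)) a

  add-new : ¬ Adj G u v → ∀ {i j} → SamePair u v i j → Adj (toggle u v G) i j
  add-new ¬uv {i} {j} p = trans (toggle-on G p) (cong not (Bool.¬-not (¬uv ∘ SamePair-Adj p)))

  add-old : ¬ Adj G u v → ∀ {i j} → Adj G i j → Adj (toggle u v G) i j
  add-old ¬uv a = remove← a (λ p → ¬uv (SamePair-Adj p a))

  add→ : ∀ {i j} → Adj (toggle u v G) i j → SamePair u v i j ⊎ Adj G i j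
  add→ {i} {j} a with samePair? u v i j
  ... | yes p = inj₁ p
  ... | no ¬p = inj₂ (Adj-cong (toggle u v G) G (toggle-off G ¬p) a)

  -- The new edge brings the two arcs uv and vu, which are distinct as there are no loops and
  -- disjoint from the old arcs as uv was missing.
  add-arcs : u ≢ v → ¬ Adj G u v → trueEntries (toggle u v G) ≡ 2 + trueEntries G
  add-arcs u≢v ¬uv = trans (sym (arcs-trueEntries (toggle u v G)))
    (trans (⅀-cong pointwise)
    (trans (⅀-+ {A = Fin n × Fin n} _ _)
    (trans (cong₂ _+_ (⅀-+ {A = Fin n × Fin n} _ _) (arcs-trueEntries G))
           (cong₂ (λ a b → a + b + trueEntries G) (⅀-pair u v) (⅀-pair v u)))))
    where
    pointwise : (p : Fin n × Fin n) → let (i , j) = p in ι (adj? (toggle u v G) i j) ≡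
      ι (i Fin.≟ u ×-dec j Fin.≟ v) + ι (i Fin.≟ v ×-dec j Fin.≟ u) + ι (adj? G i j)
    pointwise (i , j) = trans
      (ι-cong add→ [ add-new ¬uv , add-old ¬uv ]′ (adj? (toggle u v G) i j) (samePair? u v i j ⊎-dec adj? G i j))
      (trans (ι-⊎ (λ (p , a) → ¬uv (SamePair-Adj p a)) (samePair? u v i j) (adj? G i j))
             (cong (_+ ι (adj? G i j)) (ι-⊎ (λ { ((refl , _) , (eq , _)) → u≢v eq })
               (i Fin.≟ u ×-dec j Fin.≟ v) (i Fin.≟ v ×-dec j Fin.≟ u))))

  add-edges : u ≢ v → ¬ Adj G u v → ∀ {m} → HasEdges G m → HasEdges (toggle u v G) (suc m)
  add-edges u≢v ¬uv {m} h = trans (add-arcs u≢v ¬uv) (trans (cong (2 +_) h) (sym (*-suc 2 m)))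

-- Read backwards: toggling uv once more adds the edge to the smaller graph and gives back G.
remove-edges : ∀ {n} {G : Graph n} → Simple G → ∀ {u v} → Adj G u v →
               ∀ {m} → HasEdges G (suc m) → HasEdges (toggle u v G) m
remove-edges {G = G} sG {u} {v} uv {m} h = +-cancelˡ-≡ 2 _ _
  (trans (sym (add-arcs (toggle-simple (Adj-irrefl sG uv) sG) (Adj-irrefl sG uv)
                        (λ a → proj₂ (remove→ sG uv a) (inj₁ (refl , refl)))))
         (trans (cong trueEntries (toggle-involutive u v G)) (trans h (*-suc 2 m))))

-- Walks and connectedness

module _ {n} {G : Graph n} where

  _++ʷ_ : ∀ {i j l} → Walk G i j → Walk G j l → Walk G i l
  here     ++ʷ w′ = w′
  step a w ++ʷ w′ = step a (w ++ʷ w′)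

  reverseʷ : Simple G → ∀ {i j} → Walk G i j → Walk G j i
  reverseʷ sG here       = here
  reverseʷ sG (step a w) = reverseʷ sG w ++ʷ step (Adj-sym sG a) here

  edge : ∀ {i j} → Adj G i j → Walk G i j
  edge a = step a here

-- An edge may be sent to a whole walk, so a modified graph is connected as soon as every deleted
-- edge has a detour.
mapʷ : ∀ {n} {G G′ : Graph n} → (∀ {i j} → Adj G i j → Walk G′ i j) → ∀ {i j} → Walk G i j → Walk G′ i j
mapʷ f here       = here
mapʷ f (step a w) = f a ++ʷ mapʷ f w

connected-via : ∀ {n} {G : Graph n} → Simple G → (x : Fin n) → (∀ i → Walk G i x) → Connected G
connected-via sG x f i j = f i ++ʷ reverseʷ sG (f j)

record Valid {n} (m : ℕ) (G : Graph n) : Set where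
  constructor valid
  field
    isSimple    : Simple G
    hasEdges    : HasEdges G m
    isConnected : Connected G

open Valid

add-valid : ∀ {n m} {G : Graph n} {u v} → Valid m G → u ≢ v → ¬ Adj G u v → Valid (suc m) (toggle u v G)
add-valid {m = m} (valid sG edges connected) u≢v ¬uv = valid
  (toggle-simple u≢v sG) (add-edges sG u≢v ¬uv {m} edges)
  (λ i j → mapʷ (edge ∘ add-old sG ¬uv) (connected i j))

-- The 2-core

data TwoNeighbours {n} (G : Graph n) (X : Fin n → Set) (v : Fin n) : Set where
  two : ∀ p q → p ≢ q → X p × Adj G v p → X q × Adj G v q → TwoNeighbours G X v

-- The 2-core as the union of all vertex sets in which every vertex has two neighbours. The sets are
-- bit vectors, so membership can be decided by search.
data InCore {n} (G : Graph n) (v : Fin n) : Set where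
  inDense : (S : Subset n) →
            (∀ v → lookup S v ≡ true → TwoNeighbours G (λ p → lookup S p ≡ true) v) →
            lookup S v ≡ true → InCore G v

abstract
  core? : ∀ {n} (G : Graph n) v → Dec (InCore G v)
  core? G v = map′ (λ (S , dense , v∈S) → inDense S dense v∈S) (λ { (inDense S dense v∈S) → S , dense , v∈S })
    (anySubset? λ S → Fin.all? (dense? S) ×-dec (lookup S v Bool.≟ true))
    where
    dense? : ∀ S v → Dec (lookup S v ≡ true → TwoNeighbours G (λ p → lookup S p ≡ true) v)
    dense? S v = (lookup S v Bool.≟ true) →-dec
      map′ (λ (p , q , p≢q , xp , xq) → two p q p≢q xp xq) (λ { (two p q p≢q xp xq) → p , q , p≢q , xp , xq })
      (Fin.any? λ p → Fin.any? λ q →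
        ¬? (p Fin.≟ q) ×-dec ((lookup S p Bool.≟ true) ×-dec adj? G v p)
                       ×-dec ((lookup S q Bool.≟ true) ×-dec adj? G v q))

TwoNeighbours-map : ∀ {n} {G : Graph n} {X Y : Fin n → Set} {v} → (∀ {i} → X i → Y i) →
                    TwoNeighbours G X v → TwoNeighbours G Y v
TwoNeighbours-map f (two p q p≢q (xp , ap) (xq , aq)) = two p q p≢q (f xp , ap) (f xq , aq)

-- The set witnessing that v is in the core consists of core vertices, since it witnesses the same
-- for each of its elements.
core-two : ∀ {n} {G : Graph n} {v} → InCore G v → TwoNeighbours G (InCore G) v
core-two {v = v} (inDense S dense v∈S) = TwoNeighbours-map (inDense S dense) (dense v v∈S)

-- The way to show that vertices lie in the core: a decidable self-supporting set is turned into a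
-- bit vector and serves as the witness.
core-maximal : ∀ {n} {G : Graph n} {X : Fin n → Set} → (∀ v → Dec (X v)) →
               (∀ {v} → X v → TwoNeighbours G X v) → ∀ {v} → X v → InCore G v
core-maximal {G = G} {X} X? dense {v} x =
  inDense S (λ v v∈S → TwoNeighbours-map to (dense (from v∈S))) (to x)
  where
  S = tabulate (does ∘ X?)
  to : ∀ {v} → X v → lookup S v ≡ true
  to {v} x = trans (Vec.lookup∘tabulate _ v) (dec-true (X? v) x)
  from : ∀ {v} → lookup S v ≡ true → X v
  from {v} eq = case X? v of λ
    { (yes x) → x
    ; (no ¬x) → contradiction (trans (sym eq) (trans (Vec.lookup∘tabulate _ v) (dec-false (X? v) ¬x))) λ () }

-- Simple paths and how they enlarge the core

-- The index lists the vertices visited, so that a path can be used as a vertex set in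
-- `core-maximal`.
data SimplePath {n} (E : Fin n → Fin n → Set) : Fin n → Fin n → List (Fin n) → Set where
  [_] : ∀ j → SimplePath E j j (j ∷ [])
  _⟨_⟩∷_ : ∀ {i i′ j l} → E i i′ → i ∉ l → SimplePath E i′ j l → SimplePath E i j (i ∷ l)

module _ {n} {E : Fin n → Fin n → Set} where

  open DecMembership (Fin._≟_ {n}) using (_∈?_)

  start∈ : ∀ {i j l} → SimplePath E i j l → i ∈ l
  start∈ [ _ ]          = here refl
  start∈ (_ ⟨ _ ⟩∷ _)   = here refl

  suffix : ∀ {i j x l} → SimplePath E i j l → x ∈ l → ∃ λ l′ → SimplePath E x j l′
  suffix [ j ]            (here refl) = _ , [ j ]
  suffix p@(_ ⟨ _ ⟩∷ _)   (here refl) = _ , p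
  suffix (_ ⟨ _ ⟩∷ p)     (there x∈)  = suffix p x∈

  -- If the new start already occurs on the path, the part before its occurrence is dropped.
  extend : ∀ {i i′ j} → E i i′ → (∃ λ l → SimplePath E i′ j l) → ∃ λ l → SimplePath E i j l
  extend {i} e (l , p) with i ∈? l
  ... | yes i∈ = suffix p i∈
  ... | no i∉  = _ , (e ⟨ i∉ ⟩∷ p)

  erase : ∀ {i j} → Star E i j → ∃ λ l → SimplePath E i j l
  erase ε        = _ , [ _ ]
  erase (e ◅ es) = extend e (erase es)

  second : ∀ {i j l} → i ≢ j → SimplePath E i j l → ∃ λ p → p ∈ l × E i p
  second i≢j [ _ ]          = contradiction refl i≢j
  second i≢j (e ⟨ _ ⟩∷ p)   = _ , there (start∈ p) , e

  penultimate : ∀ {i j l} → i ≢ j → SimplePath E i j l → ∃ λ p → p ∈ l × E p j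
  penultimate i≢j [ _ ] = contradiction refl i≢j
  penultimate {j = j} i≢j (_⟨_⟩∷_ {i′ = i′} e _ p) with i′ Fin.≟ j
  ... | yes refl = _ , here refl , e
  ... | no i′≢j  = let (q , q∈ , eq) = penultimate i′≢j p in q , there q∈ , eq

module _ {n} {G : Graph n} (sG : Simple G) {E : Fin n → Fin n → Set} (E⊆ : ∀ {i j} → E i j → Adj G i j) where

  open DecMembership (Fin._≟_ {n}) using (_∈?_)

  -- An interior vertex has a predecessor and a successor on the path, and these differ because no
  -- vertex repeats.
  interior-two : ∀ {i j l v} → SimplePath E i j l → v ∈ l → v ≡ i ⊎ v ≡ j ⊎ TwoNeighbours G (_∈ l) v
  interior-two [ _ ]        (here eq)  = inj₁ eq
  interior-two (_ ⟨ _ ⟩∷ _) (here eq)  = inj₁ eq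
  interior-two {j = j} {v = v} (e ⟨ i∉ ⟩∷ p) (there v∈) with interior-two p v∈
  ... | inj₂ (inj₁ v≡j) = inj₂ (inj₁ v≡j)
  ... | inj₂ (inj₂ t) = inj₂ (inj₂ (TwoNeighbours-map there t))
  ... | inj₁ refl with v Fin.≟ j
  ...   | yes v≡j = inj₂ (inj₁ v≡j)
  ...   | no v≢j with second v≢j p
  ...     | q , q∈ , vq = inj₂ (inj₂ (two _ q (λ { refl → i∉ q∈ })
              (here refl , Adj-sym sG (E⊆ e)) (there q∈ , E⊆ vq)))

  -- X together with the path supports itself: interior vertices have two neighbours on the path,
  -- and the ends belong to X.
  path⊆core : ∀ {i j l} {X : Fin n → Set} → (∀ v → Dec (X v)) → SimplePath E i j l → X i → X j →
              (∀ {v} → X v → TwoNeighbours G (λ w → X w ⊎ w ∈ l) v) → ∀ {v} → X v ⊎ v ∈ l → InCore G v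
  path⊆core {l = l} {X} X? p xi xj dense = core-maximal (λ v → X? v ⊎-dec v ∈? l) λ
    { (inj₁ x)  → dense x
    ; (inj₂ v∈) → case interior-two p v∈ of λ
      { (inj₁ refl)        → dense xi
      ; (inj₂ (inj₁ refl)) → dense xj
      ; (inj₂ (inj₂ t))    → TwoNeighbours-map inj₂ t } }

Walk⇒Star : ∀ {n} {G : Graph n} {i j} → Walk G i j → Star (Adj G) i j
Walk⇒Star here       = ε
Walk⇒Star (step a w) = a ◅ Walk⇒Star w

-- The new edge closes a cycle with a path from u to v in the old graph. The path neighbour of an
-- end is not the other end, since uv was not an edge.
added-edge⊆core : ∀ {n} {G : Graph n} {u v} → Simple G → Connected G → u ≢ v → ¬ Adj G u v →
                  InCore (toggle u v G) u × InCore (toggle u v G) v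
added-edge⊆core {n} {G} {u} {v} sG connected u≢v ¬uv
  with erase (Walk⇒Star (connected u v))
... | l , path = inCore (inj₁ (inj₁ refl)) , inCore (inj₁ (inj₂ refl))
  where
  sG′ = toggle-simple u≢v sG
  End : Fin n → Set
  End i = i ≡ u ⊎ i ≡ v
  dense : ∀ {i} → End i → TwoNeighbours (toggle u v G) (λ w → End w ⊎ w ∈ l) i
  dense (inj₁ refl) with second u≢v path
  ... | p , p∈ , up = two v p (λ { refl → ¬uv up })
    (inj₁ (inj₂ refl) , add-new sG ¬uv (inj₁ (refl , refl))) (inj₂ p∈ , add-old sG ¬uv up)
  dense (inj₂ refl) with penultimate u≢v path
  ... | p , p∈ , pv = two u p (λ { refl → ¬uv pv })
    (inj₁ (inj₁ refl) , add-new sG ¬uv (inj₂ (refl , refl)))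
    (inj₂ p∈ , add-old sG ¬uv (Adj-sym sG pv))
  inCore : ∀ {i} → End i ⊎ i ∈ l → InCore (toggle u v G) i
  inCore = path⊆core sG′ (add-old sG ¬uv) (λ i → i Fin.≟ u ⊎-dec i Fin.≟ v) path
    (inj₁ refl) (inj₂ refl) dense

-- Trees hanging off the core

-- Ext G v w: the tree hanging off the core that contains v is rooted at w.
data Ext {n} (G : Graph n) : Fin n → Fin n → Set where
  root : ∀ {w} → InCore G w → Ext G w w
  hang : ∀ {v v′ w} → ¬ InCore G v → Adj G v v′ → Ext G v′ w → Ext G v w

Ext-core : ∀ {n} {G : Graph n} {v w} → Ext G v w → InCore G w
Ext-core (root c)     = c
Ext-core (hang _ _ e) = Ext-core e

Ext-fixed : ∀ {n} {G : Graph n} {v w} → InCore G v → Ext G v w → v ≡ w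
Ext-fixed c (root _)      = refl
Ext-fixed c (hang ¬c _ _) = contradiction c ¬c

module _ {n} {G : Graph n} (sG : Simple G) where

  Outer : Fin n → Fin n → Set
  Outer i j = Adj G i j × (¬ InCore G i ⊎ ¬ InCore G j)

  Ext⇒Star : ∀ {v w} → Ext G v w → Star Outer v w
  Ext⇒Star (root _)      = ε
  Ext⇒Star (hang ¬c a e) = (a , inj₁ ¬c) ◅ Ext⇒Star e

  -- A path through the complement of the core joining two distinct core vertices could be added to the core.
  Ext-unique : ∀ {v w w′} → Ext G v w → Ext G v w′ → w ≡ w′
  Ext-unique {v} {w} {w′} e e′ with w Fin.≟ w′
  ... | yes eq = eq
  ... | no w≢w′ with erase (reverse (λ (a , o) → Adj-sym sG a , ⊎-swap o) (Ext⇒Star e) ◅◅ Ext⇒Star e′)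
  ...   | l , path with second w≢w′ path
  ...     | p , p∈ , _ , inj₁ ¬w = contradiction (Ext-core e) ¬w
  ...     | p , p∈ , _ , inj₂ ¬p = contradiction
              (path⊆core sG proj₁ (core? G) path (Ext-core e) (Ext-core e′)
                 (TwoNeighbours-map inj₁ ∘ core-two) (inj₂ p∈)) ¬p

  -- The first core vertex on a walk towards the core is the root.
  Ext-exists : ∀ {v c} → InCore G c → Walk G v c → ∃ (Ext G v)
  Ext-exists {v} cc w with core? G v
  Ext-exists {v} cc w          | yes cv = v , root cv
  Ext-exists {v} cc here       | no ¬cv = contradiction cc ¬cv
  Ext-exists {v} cc (step a w) | no ¬cv = let (r , e) = Ext-exists cc w in r , hang ¬cv a e

  ext? : Connected G → ∀ v c → Dec (Ext G v c)
  ext? connected v c with core? G c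
  ... | no ¬cc = no (¬cc ∘ Ext-core)
  ... | yes cc with Ext-exists cc (connected v c)
  ...   | r , e with r Fin.≟ c
  ...     | yes refl = yes e
  ...     | no r≢c   = no (r≢c ∘ Ext-unique e)

  -- A hanging tree is attached through its root alone: an edge leaves the tree of c only by joining
  -- c to another core vertex. If a core vertex j is adjacent to a vertex i outside the core, then j
  -- is itself a root of i, hence equal to c.
  Ext-step : ∀ {i j c} → Ext G i c → Adj G i j → Ext G j c ⊎ (i ≡ c × InCore G j)
  Ext-step {i} {j} e a with core? G i
  ... | yes ci with Ext-fixed ci e
  ...   | refl with core? G j
  ...     | yes cj = inj₂ (refl , cj)
  ...     | no ¬cj = inj₁ (hang ¬cj (Adj-sym sG a) e)
  Ext-step {i} {j} e a | no ¬ci with core? G j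
  ...     | no ¬cj = inj₁ (hang ¬cj (Adj-sym sG a) e)
  ...     | yes cj with Ext-unique e (hang ¬ci a (root cj))
  ...       | refl = inj₁ (root cj)

-- Edges spanned by a vertex set

size : ∀ {n} {X : Fin n → Set} → (∀ v → Dec (X v)) → ℕ
size X? = ⅀ (λ v → ι (X? v))

inner : ∀ {n} {X : Fin n → Set} → Graph n → (∀ v → Dec (X v)) → ℕ
inner {n} G X? = ⅀ (λ ((u , v) : Fin n × Fin n) → ι (X? u ×-dec X? v ×-dec adj? G u v))

size≤ : ∀ {n} {X : Fin n → Set} (X? : ∀ v → Dec (X v)) → size X? ≤ n
size≤ {n} X? = ≤-trans (⅀-bound n 1 (λ v → ι≤1 (X? v))) (≤-reflexive (*-identityʳ n))

inner≤arcs : ∀ {n} {X : Fin n → Set} (G : Graph n) (X? : ∀ v → Dec (X v)) → inner G X? ≤ arcs G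
inner≤arcs {n} G X? = ⅀-mono {A = Fin n × Fin n}
  (λ (u , v) → ι-mono (proj₂ ∘ proj₂) (X? u ×-dec X? v ×-dec adj? G u v) (adj? G u v))

crossing : ∀ {n} {G : Graph n} {X : Fin n → Set} (X? : ∀ v → Dec (X v)) {i j} →
           Walk G i j → X i → ¬ X j → ∃ λ u → ∃ λ v → X u × ¬ X v × Adj G u v
crossing X? here xi ¬xj = contradiction xi ¬xj
crossing X? (step {i} {j} a w) xi ¬xl with X? j
... | yes xj = crossing X? w xj ¬xl
... | no ¬xj = i , j , xi , ¬xj , a

module _ {n k} {G : Graph n} (vG : Valid (n + k) G) where

  -- Each vertex adjacent to a set adds at least one edge to it, and there are n + k edges in the end.
  inner-bound-nonempty : ∀ f {X : Fin n → Set} (X? : ∀ v → Dec (X v)) → n ≤ size X? + f → ∃ X →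
                         inner G X? ≤ 2 * size X? + 2 * k
  inner-bound-nonempty f {X} X? enough (x , Xx) with Fin.any? (λ v → ¬? (X? v))
  ... | no all = ≤-trans (inner≤arcs G X?) (≤-trans (≤-reflexive (trans (arcs-trueEntries G)
                   (trans (hasEdges vG) (*-distribˡ-+ 2 n k))))
                   (+-monoˡ-≤ (2 * k) (*-monoʳ-≤ 2 (≤-reflexive full))))
    where
    full : n ≡ size X?
    full = sym (trans (⅀-cong (λ v → ι-yes (decidable-stable (X? v) (λ ¬x → all (v , ¬x))) (X? v)))
                      (trans (⅀-const n 1) (*-identityʳ n)))
  ... | yes (v , ¬Xv) with crossing X? (isConnected vG x v) Xx ¬Xv
  ...   | p , q , Xp , ¬Xq , pq = extended f enough
    where
    Y? : ∀ v → Dec (X v ⊎ v ≡ q)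
    Y? v = X? v ⊎-dec v Fin.≟ q
    size-Y : size Y? ≡ size X? + 1
    size-Y = trans (⅀-cong (λ v → ι-⊎ (λ { (Xq , refl) → ¬Xq Xq }) (X? v) (v Fin.≟ q)))
      (trans (⅀-+ (λ v → ι (X? v)) (λ v → ι (v Fin.≟ q))) (cong (size X? +_) (⅀-single q)))
    inner-Y : inner G X? + 1 + 1 ≤ inner G Y?
    inner-Y = ≤-trans (≤-reflexive (sym (trans (⅀-+ {A = Fin n × Fin n} _ _) (cong₂ _+_
        (trans (⅀-+ {A = Fin n × Fin n} _ _) (cong (inner G X? +_) (⅀-pair p q))) (⅀-pair q p)))))
      (⅀-mono {A = Fin n × Fin n} λ (u , v) → ι-disjoint
        (λ { ((_ , Xq , _) , (_ , refl)) → ¬Xq Xq })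
        (λ { ((Xq , _) , (refl , _)) → ¬Xq Xq })
        (λ { ((refl , _) , (refl , _)) → ¬Xq Xp })
        (λ (Xu , Xv , a) → inj₁ Xu , inj₁ Xv , a)
        (λ { (refl , refl) → inj₁ Xp , inj₂ refl , pq })
        (λ { (refl , refl) → inj₂ refl , inj₁ Xp , Adj-sym (isSimple vG) pq })
        (X? u ×-dec X? v ×-dec adj? G u v) (u Fin.≟ p ×-dec v Fin.≟ q) (u Fin.≟ q ×-dec v Fin.≟ p)
        (Y? u ×-dec Y? v ×-dec adj? G u v))
    -- `f` bounds the number of vertices outside X. It cannot be 0 here, since X and q together
    -- would then exceed n vertices. Adding q raises the inner arcs by at least 2 and the bound by
    -- exactly 2.
    extended : ∀ f → n ≤ size X? + f → inner G X? ≤ 2 * size X? + 2 * k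
    extended zero enough = contradiction
      (≤-trans (≤-reflexive (sym size-Y)) (≤-trans (size≤ Y?) (≤-trans enough (≤-reflexive (+-identityʳ _)))))
      (m+1+n≰m (size X?))
    extended (suc f) enough = +-cancelʳ-≤ 2 _ _ (≤-trans (≤-reflexive (sym (+-assoc (inner G X?) 1 1)))
      (≤-trans inner-Y
      (≤-trans (inner-bound-nonempty f Y? (≤-trans enough (≤-reflexive (trans (sym (+-assoc (size X?) 1 f)) (cong (_+ f) (sym size-Y)))))
                 (x , inj₁ Xx))
      (≤-reflexive (trans (cong (λ s → 2 * s + 2 * k) size-Y) (shift (size X?) k))))))
      where
      shift : ∀ s k → 2 * (s + 1) + 2 * k ≡ 2 * s + 2 * k + 2
      shift = solve-∀

  inner-bound : ∀ {X : Fin n → Set} (X? : ∀ v → Dec (X v)) → inner G X? ≤ 2 * size X? + 2 * k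
  inner-bound X? with Fin.any? X?
  ... | yes e = inner-bound-nonempty n X? (m≤n+m n (size X?)) e
  ... | no ¬e = subst (_≤ 2 * size X? + 2 * k)
    (sym (⅀-zero {A = Fin n × Fin n} (λ (u , v) → ι-no (λ (x , _) → ¬e (u , x)) (X? u ×-dec X? v ×-dec adj? G u v)))) z≤n

-- Deleting two edges at a vertex

detach : ∀ {n} → (p q r : Fin n) → Graph n → Graph n
detach p q r G = toggle p r (toggle p q G)

module Detach {n} {G : Graph n} (sG : Simple G) {p q r : Fin n} (pq : Adj G p q) (pr : Adj G p r) (q≢r : q ≢ r) where

  p≢q : p ≢ q
  p≢q = Adj-irrefl sG pq

  p≢r : p ≢ r
  p≢r = Adj-irrefl sG pr

  sG₁ : Simple (toggle p q G)
  sG₁ = toggle-simple p≢q sG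

  pr₁ : Adj (toggle p q G) p r
  pr₁ = remove← sG pr λ { (inj₁ (_ , r≡q)) → q≢r (sym r≡q) ; (inj₂ (p≡q , _)) → p≢q p≡q }

  detach-simple : Simple (detach p q r G)
  detach-simple = toggle-simple p≢r sG₁

  detach-edges : ∀ {m} → HasEdges G (2 + m) → HasEdges (detach p q r G) m
  detach-edges {m} h = remove-edges sG₁ pr₁ {m} (remove-edges sG pq {suc m} h)

  detach→ : ∀ {i j} → Adj (detach p q r G) i j → Adj G i j × ¬ SamePair p q i j × ¬ SamePair p r i j
  detach→ a = let (a₁ , ¬pr) = remove→ sG₁ pr₁ a ; (a₀ , ¬pq) = remove→ sG pq a₁ in a₀ , ¬pq , ¬pr

  detach← : ∀ {i j} → Adj G i j → ¬ SamePair p q i j → ¬ SamePair p r i j → Adj (detach p q r G) i j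
  detach← a ¬pq ¬pr = remove← sG₁ (remove← sG a ¬pq) ¬pr

  detach-cases : ∀ {i j} → Adj G i j → SamePair p q i j ⊎ SamePair p r i j ⊎ Adj (detach p q r G) i j
  detach-cases {i} {j} a with samePair? p q i j | samePair? p r i j
  ... | yes s | _      = inj₁ s
  ... | no _  | yes s  = inj₂ (inj₁ s)
  ... | no ¬s | no ¬s′ = inj₂ (inj₂ (detach← a ¬s ¬s′))

detach-injective : ∀ {n} (p q r : Fin n) {G G′ : Graph n} → detach p q r G ≡ detach p q r G′ → G ≡ G′
detach-injective p q r = toggle-injective p q ∘ toggle-injective p r

-- Breaking up a triangle

module Triangle {n m} {G : Graph n} (vG : Valid (2 + m) G) {a b c : Fin n}
                (ab : Adj G a b) (bc : Adj G b c) (ca : Adj G c a) where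

  sG = isSimple vG
  a≢b = Adj-irrefl sG ab
  b≢c = Adj-irrefl sG bc
  c≢a = Adj-irrefl sG ca

  module B = Detach sG bc (Adj-sym sG ab) c≢a
  module C = Detach sG (Adj-sym sG bc) ca (a≢b ∘ sym)

  D = detach b c a G

  ca-D : Adj D c a
  ca-D = B.detach← ca
    (λ { (inj₁ (c≡b , _)) → b≢c (sym c≡b) ; (inj₂ (_ , a≡b)) → a≢b a≡b })
    (λ { (inj₁ (c≡b , _)) → b≢c (sym c≡b) ; (inj₂ (c≡a , _)) → c≢a c≡a })

  -- Both deleted edges end at b. Until a walk to b meets one of them it survives in D, and at that
  -- point it stands at b, at a, or at c, which is still joined to a.
  split : ∀ {z} → Walk G z b → Walk D z b ⊎ Walk D z a
  split here = inj₁ here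
  split (step e w) with B.detach-cases e
  ... | inj₁ (inj₁ (refl , _))        = inj₁ here
  ... | inj₁ (inj₂ (refl , _))        = inj₂ (edge ca-D)
  ... | inj₂ (inj₁ (inj₁ (refl , _))) = inj₁ here
  ... | inj₂ (inj₁ (inj₂ (refl , _))) = inj₂ here
  ... | inj₂ (inj₂ e′) with split w
  ...   | inj₁ w′ = inj₁ (step e′ w′)
  ...   | inj₂ w′ = inj₂ (step e′ w′)

  detached-valid : Connected D → Valid m D
  detached-valid = valid B.detach-simple (B.detach-edges {m} (hasEdges vG))

  separated : ¬ Connected D → ¬ Walk D b a
  separated ¬con w = ¬con (connected-via B.detach-simple a λ i →
    [ _++ʷ w , id ]′ (split (isConnected vG i b)))

  module _ (sep : ¬ Walk D b a) {z : Fin n} where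

    -- For z on the side of a, the edge bz joins the two parts again. The adjacencies are recorded
    -- because the arcs (b, z) and (a, c) of H name all four vertices, which limits the preimages of
    -- H to pairs of arcs.
    reattach-b : Walk D z a → let H = toggle b z D in Valid (suc m) H × Adj H b z × Adj H a c
    reattach-b w = valid (toggle-simple b≢z B.detach-simple)
        (add-edges B.detach-simple b≢z ¬bz {m} (B.detach-edges {m} (hasEdges vG)))
        (connected-via (toggle-simple b≢z B.detach-simple) a λ i →
          [ (λ w′ → old w′ ++ʷ step bz (old w)) , old ]′ (split (isConnected vG i b))) ,
      bz , add-old B.detach-simple ¬bz (Adj-sym B.detach-simple ca-D)
      where
      b≢z : b ≢ z
      b≢z refl = sep w
      ¬bz : ¬ Adj D b z
      ¬bz e = sep (step e w)
      old : ∀ {i j} → Walk D i j → Walk (toggle b z D) i j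
      old = mapʷ (edge ∘ add-old B.detach-simple ¬bz)
      bz : Adj (toggle b z D) b z
      bz = add-new B.detach-simple ¬bz (inj₁ (refl , refl))

    -- For z on the side of b, the vertex c is cut off instead: bc and ca are deleted, ab stays, and
    -- c is attached to z. The arcs (c, z) and (a, b) again name all four vertices.
    reattach-c : Walk D z b → let H = toggle c z (detach c b a G) in Valid (suc m) H × Adj H c z × Adj H a b
    reattach-c w = valid sH
        (add-edges C.detach-simple c≢z ¬cz {m} (C.detach-edges {m} (hasEdges vG)))
        (λ i j → mapʷ edge′ (isConnected vG i j)) ,
      cz , add-old C.detach-simple ¬cz ab-C
      where
      H = toggle c z (detach c b a G)
      sep-c : ¬ Walk D c b
      sep-c w′ = sep (reverseʷ B.detach-simple w′ ++ʷ edge ca-D)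
      c≢z : c ≢ z
      c≢z refl = sep-c w
      ¬cz : ¬ Adj (detach c b a G) c z
      ¬cz e = let (e₀ , ¬cb , _) = C.detach→ e in sep-c (step (B.detach← e₀
        (λ { (inj₁ (c≡b , _)) → b≢c (sym c≡b) ; (inj₂ (_ , z≡b)) → ¬cb (inj₁ (refl , z≡b)) })
        (λ { (inj₁ (c≡b , _)) → b≢c (sym c≡b) ; (inj₂ (c≡a , _)) → c≢a c≡a })) w)
      sH : Simple H
      sH = toggle-simple c≢z C.detach-simple
      cz : Adj H c z
      cz = add-new C.detach-simple ¬cz (inj₁ (refl , refl))
      ab-C : Adj (detach c b a G) a b
      ab-C = C.detach← ab
        (λ { (inj₁ (a≡c , _)) → c≢a (sym a≡c) ; (inj₂ (a≡b , _)) → a≢b a≡b })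
        (λ { (inj₁ (a≡c , _)) → c≢a (sym a≡c) ; (inj₂ (_ , b≡c)) → b≢c b≡c })
      -- A walk of D ending at b visits neither a nor c, which lie in the other part, so it also
      -- survives the deletion of ca.
      transfer : ∀ {i} → Walk D i b → Walk (detach c b a G) i b
      transfer here = here
      transfer w₀@(step e w₁) with C.detach-cases (proj₁ (B.detach→ e))
      ... | inj₁ s = contradiction (swap-ends s) (proj₁ (proj₂ (B.detach→ e)))
        where
        swap-ends : ∀ {u v i j : Fin n} → SamePair u v i j → SamePair v u i j
        swap-ends (inj₁ s) = inj₂ s
        swap-ends (inj₂ s) = inj₁ s
      ... | inj₂ (inj₁ (inj₁ (refl , _))) = contradiction w₀ sep-c
      ... | inj₂ (inj₁ (inj₂ (refl , _))) = contradiction (reverseʷ B.detach-simple w₀) sep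
      ... | inj₂ (inj₂ e′) = step e′ (transfer w₁)
      old : ∀ {i j} → Walk (detach c b a G) i j → Walk H i j
      old = mapʷ (edge ∘ add-old C.detach-simple ¬cz)
      cb : Walk H c b
      cb = step cz (old (transfer w))
      ca′ : Walk H c a
      ca′ = cb ++ʷ reverseʷ sH (old (edge ab-C))
      edge′ : ∀ {i j} → Adj G i j → Walk H i j
      edge′ e with C.detach-cases e
      ... | inj₁ (inj₁ (refl , refl))        = cb
      ... | inj₁ (inj₂ (refl , refl))        = reverseʷ sH cb
      ... | inj₂ (inj₁ (inj₁ (refl , refl))) = ca′
      ... | inj₂ (inj₁ (inj₂ (refl , refl))) = reverseʷ sH ca′
      ... | inj₂ (inj₂ e′)                   = old (edge e′)

-- Pulling a vertex out of the core

-- Steps that do not start at c. A sequence of them can visit c only as its last vertex.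
Avoiding : ∀ {n} → Graph n → Fin n → Fin n → Fin n → Set
Avoiding G c i j = Adj G i j × i ≢ c

pull : ∀ {n} → (c x y z : Fin n) → Graph n → Graph n
pull c x y z G = toggle c z (toggle x y (detach c x y G))

pull-injective : ∀ {n} (c x y z : Fin n) {G G′ : Graph n} → pull c x y z G ≡ pull c x y z G′ → G ≡ G′
pull-injective c x y z = detach-injective c x y ∘ toggle-injective x y ∘ toggle-injective c z

module Pull {n m} {G : Graph n} (vG : Valid (2 + m) G) {c x y z : Fin n}
            (core-c : InCore G c) (cx : Adj G c x) (core-x : InCore G x) (cy : Adj G c y) (core-y : InCore G y)
            (x≢y : x ≢ y) (only : ∀ {w} → InCore G w → Adj G c w → w ≡ x ⊎ w ≡ y)
            (¬xy : ¬ Adj G x y) (¬Ext-z : ¬ Ext G z c) where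

  open Detach (isSimple vG) cx cy x≢y renaming (p≢q to c≢x; p≢r to c≢y)

  sG = isSimple vG
  D = detach c x y G
  D₁ = toggle x y D
  H = pull c x y z G

  T : Fin n → Set
  T v = Ext G v c

  T? : ∀ v → Dec (T v)
  T? v = ext? sG (isConnected vG) v c

  T-c : T c
  T-c = root core-c

  ¬T-x : ¬ T x
  ¬T-x t = c≢x (sym (Ext-fixed core-x t))

  ¬T-y : ¬ T y
  ¬T-y t = c≢y (sym (Ext-fixed core-y t))

  ¬xy-D : ¬ Adj D x y
  ¬xy-D = ¬xy ∘ proj₁ ∘ detach→

  sD₁ : Simple D₁
  sD₁ = toggle-simple x≢y detach-simple

  c≢z : c ≢ z
  c≢z refl = ¬Ext-z T-c

  -- A neighbour of c outside the core belongs to the tree of c, which z does not. The only core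
  -- neighbours were x and y, and those edges have been deleted.
  ¬cz : ¬ Adj D₁ c z
  ¬cz e with add→ detach-simple e
  ... | inj₁ (inj₁ (c≡x , _)) = c≢x c≡x
  ... | inj₁ (inj₂ (c≡y , _)) = c≢y c≡y
  ... | inj₂ e′ with core? G z | detach→ e′
  ...   | no ¬core-z | e₀ , _ , _ = ¬Ext-z (hang ¬core-z (Adj-sym sG e₀) T-c)
  ...   | yes core-z | e₀ , ¬cx , ¬cy with only core-z e₀
  ...     | inj₁ z≡x = ¬cx (inj₁ (refl , z≡x))
  ...     | inj₂ z≡y = ¬cy (inj₁ (refl , z≡y))

  sH : Simple H
  sH = toggle-simple c≢z sD₁

  edge-D : ∀ {i j} → Adj D i j → Adj H i j
  edge-D = add-old sD₁ ¬cz ∘ add-old detach-simple ¬xy-D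

  xy-H : Adj H x y
  xy-H = add-old sD₁ ¬cz (add-new detach-simple ¬xy-D (inj₁ (refl , refl)))

  cz-H : Adj H c z
  cz-H = add-new sD₁ ¬cz (inj₁ (refl , refl))

  edge-H : ∀ {i j} → Adj H i j → SamePair c z i j ⊎ SamePair x y i j ⊎ Adj D i j
  edge-H e with add→ sD₁ e
  ... | inj₁ s  = inj₁ s
  ... | inj₂ e′ = inj₂ (add→ detach-simple e′)

  -- In G the tree is left only along cx and cy, the edges from c to core vertices; in H the single
  -- edge cz takes their place.
  leave : ∀ {i j} → T i → Adj H i j → T j ⊎ (i ≡ c × j ≡ z)
  leave t e with edge-H e
  ... | inj₁ (inj₁ cz)                 = inj₂ cz
  ... | inj₁ (inj₂ (refl , _))         = contradiction t ¬Ext-z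
  ... | inj₂ (inj₁ (inj₁ (refl , _)))  = contradiction t ¬T-x
  ... | inj₂ (inj₁ (inj₂ (refl , _)))  = contradiction t ¬T-y
  ... | inj₂ (inj₂ e′) with detach→ e′
  ...   | e₀ , ¬cx , ¬cy with Ext-step sG t e₀
  ...     | inj₁ t′ = inj₁ t′
  ...     | inj₂ (refl , core-j) with only core-j e₀
  ...       | inj₁ j≡x = contradiction (inj₁ (refl , j≡x)) ¬cx
  ...       | inj₂ j≡y = contradiction (inj₁ (refl , j≡y)) ¬cy

  -- The walk is followed until it is about to enter the tree. This can happen only at c, coming
  -- from x or y, and from y the new edge leads to x.
  escape : ∀ {i} → ¬ T i → Walk G i x → Star (Avoiding H c) i x
  escape ¬t here = ε
  escape {i} ¬t (step {j = j} e w) with T? j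
  ... | no ¬t′ = (edge-D (detach← e (avoid (λ { refl → ¬t′ T-c })) (avoid (λ { refl → ¬t′ T-c }))) , λ { refl → ¬t T-c }) ◅ escape ¬t′ w
    where
    avoid : ∀ {u} → j ≢ c → ¬ SamePair c u i j
    avoid j≢c (inj₁ (refl , _)) = ¬t T-c
    avoid j≢c (inj₂ (_ , j≡c))  = j≢c j≡c
  ... | yes t with Ext-step sG t (Adj-sym sG e)
  ...   | inj₁ t′ = contradiction t′ ¬t
  ...   | inj₂ (refl , core-i) with only core-i (Adj-sym sG e)
  ...     | inj₁ refl = ε
  ...     | inj₂ refl = (Adj-sym sH xy-H , c≢y ∘ sym) ◅ ε

  z-escapes : Star (Avoiding H c) z x
  z-escapes = escape ¬Ext-z (isConnected vG z x)

  cx-H : Walk H c x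
  cx-H = step cz-H (toWalk z-escapes)
    where
    toWalk : ∀ {i j} → Star (Avoiding H c) i j → Walk H i j
    toWalk ε              = here
    toWalk ((e , _) ◅ es) = step e (toWalk es)

  -- Two edges go and two come. The route from c over z replaces cx, and the same route followed by
  -- xy replaces cy.
  pull-valid : Valid (2 + m) H
  pull-valid = valid sH
    (add-edges sD₁ c≢z ¬cz {suc m} (add-edges detach-simple x≢y ¬xy-D {m} (detach-edges {m} (hasEdges vG))))
    (λ i j → mapʷ edge′ (isConnected vG i j))
    where
    cy-H : Walk H c y
    cy-H = cx-H ++ʷ edge xy-H
    edge′ : ∀ {i j} → Adj G i j → Walk H i j
    edge′ e with detach-cases e
    ... | inj₁ (inj₁ (refl , refl))        = cx-H
    ... | inj₁ (inj₂ (refl , refl))        = reverseʷ sH cx-H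
    ... | inj₂ (inj₁ (inj₁ (refl , refl))) = cy-H
    ... | inj₂ (inj₁ (inj₂ (refl , refl))) = reverseʷ sH cy-H
    ... | inj₂ (inj₂ e′)                   = edge (edge-D e′)

  -- In H the tree T is joined to the rest by the edge cz alone, so H and c determine z.
  z-unique : ∀ {z′} → Adj H c z′ → Star (Avoiding H c) z′ x → z′ ≡ z
  z-unique e es with leave T-c e
  ... | inj₂ (_ , z′≡z) = z′≡z
  ... | inj₁ t          = contradiction (stays t es) ¬T-x
    where
    stays : ∀ {i j} → T i → Star (Avoiding H c) i j → T j
    stays t ε = t
    stays t ((e , i≢c) ◅ es) with leave t e
    ... | inj₁ t′        = stays t′ es
    ... | inj₂ (i≡c , _) = contradiction i≡c i≢c

  -- Only x and y lose a core neighbour, namely c, and each gains the other instead. The gain is a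
  -- new neighbour because xy was not an edge of G.
  core-kept : ∀ {v} → InCore G v × v ≢ c → InCore H v
  core-kept = core-maximal (λ v → core? G v ×-dec ¬? (v Fin.≟ c)) λ (core-v , v≢c) → dense v≢c core-v (core-two core-v)
    where
    X : Fin n → Set
    X v = InCore G v × v ≢ c
    old : ∀ {v w} → v ≢ c → w ≢ c → Adj G v w → Adj H v w
    old v≢c w≢c e = edge-D (detach← e
      (λ { (inj₁ (v≡c , _)) → v≢c v≡c ; (inj₂ (_ , w≡c)) → w≢c w≡c })
      (λ { (inj₁ (v≡c , _)) → v≢c v≡c ; (inj₂ (_ , w≡c)) → w≢c w≡c }))
    replace : ∀ {v q} → v ≢ c → InCore G v → Adj G v c → c ≢ q → InCore G q → Adj G v q → TwoNeighbours H X v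
    replace v≢c core-v vc c≢q core-q vq with only core-v (Adj-sym sG vc)
    ... | inj₁ refl = two y _ (λ { refl → ¬xy vq }) ((core-y , c≢y ∘ sym) , xy-H)
                        ((core-q , c≢q ∘ sym) , old v≢c (c≢q ∘ sym) vq)
    ... | inj₂ refl = two x _ (λ { refl → ¬xy (Adj-sym sG vq) }) ((core-x , c≢x ∘ sym) , Adj-sym sH xy-H)
                        ((core-q , c≢q ∘ sym) , old v≢c (c≢q ∘ sym) vq)
    dense : ∀ {v} → v ≢ c → InCore G v → TwoNeighbours G (InCore G) v → TwoNeighbours H X v
    dense v≢c core-v (two p q p≢q (core-p , vp) (core-q , vq)) with p Fin.≟ c | q Fin.≟ c
    ... | yes refl | _        = replace v≢c core-v vp p≢q core-q vq
    ... | no p≢c   | yes refl = replace v≢c core-v vq (p≢q ∘ sym) core-p vp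
    ... | no p≢c   | no q≢c   = two p q p≢q ((core-p , p≢c) , old v≢c p≢c vp) ((core-q , q≢c) , old v≢c q≢c vq)

  core-x-H : InCore H x
  core-x-H = core-kept (core-x , c≢x ∘ sym)

  core-y-H : InCore H y
  core-y-H = core-kept (core-y , c≢y ∘ sym)

  -- A dense set of H through c would meet T in a set that could be added to the core of G.
  c-removed : ¬ InCore H c
  c-removed (inDense S dense c∈S) = refute (dense c c∈S)
    where
    X : Fin n → Set
    X v = InCore G v ⊎ (lookup S v ≡ true × T v × v ≢ c)
    X-dense : ∀ {v} → X v → TwoNeighbours G X v
    X-dense (inj₁ core-v) = TwoNeighbours-map inj₁ (core-two core-v)
    X-dense {v} (inj₂ (v∈S , t , v≢c)) with dense v v∈S
    ... | two p q p≢q (p∈S , vp) (q∈S , vq) = two p q p≢q (lift p∈S vp) (lift q∈S vq)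
      where
      lift : ∀ {p} → lookup S p ≡ true → Adj H v p → X p × Adj G v p
      lift {p} p∈S e with leave t e
      ... | inj₂ (v≡c , _) = contradiction v≡c v≢c
      ... | inj₁ t′ with edge-H e
      ...   | inj₁ (inj₁ (v≡c , _))            = contradiction v≡c v≢c
      ...   | inj₁ (inj₂ (refl , _))           = contradiction t ¬Ext-z
      ...   | inj₂ (inj₁ (inj₁ (refl , _)))    = contradiction t ¬T-x
      ...   | inj₂ (inj₁ (inj₂ (refl , _)))    = contradiction t ¬T-y
      ...   | inj₂ (inj₂ e′) with p Fin.≟ c
      ...     | yes refl = inj₁ core-c , proj₁ (detach→ e′)
      ...     | no p≢c   = inj₂ (p∈S , t′ , p≢c) , proj₁ (detach→ e′)
    -- A neighbour of c in S other than z lies in the tree, so by maximality in the core of G; but c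
    -- is the only core vertex of its tree. Of two neighbours of c in S, at most one is z.
    impossible : ∀ {p} → lookup S p ≡ true → Adj H c p → p ≢ z → ⊥
    impossible {p} p∈S e p≢z with leave T-c e
    ... | inj₂ (_ , p≡z) = p≢z p≡z
    ... | inj₁ t = Adj-irrefl sH e (sym (Ext-fixed (core-maximal
            (λ v → core? G v ⊎-dec ((lookup S v Bool.≟ true) ×-dec T? v ×-dec ¬? (v Fin.≟ c)))
            X-dense (inj₂ (p∈S , t , Adj-irrefl sH e ∘ sym))) t))
    refute : ¬ TwoNeighbours H (λ p → lookup S p ≡ true) c
    refute (two p q p≢q (p∈S , cp) (q∈S , cq)) with p Fin.≟ z
    ... | no p≢z   = impossible p∈S cp p≢z
    ... | yes refl = impossible q∈S cq (p≢q ∘ sym)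

-- Counting edges and triangles over all connected graphs

record Family (n m N : ℕ) : Set where
  field
    member           : Fin N → Graph n
    member-injective : ∀ {i j} → member i ≡ member j → i ≡ j
    member-valid     : ∀ i → Valid m (member i)
    index            : ∀ {G} → Valid m G → ∃ λ i → member i ≡ G

open Family

_≟ᴳ_ : ∀ {n} (G H : Graph n) → Dec (G ≡ H)
_≟ᴳ_ = Vec.≡-dec (Vec.≡-dec Bool._≟_)

nonEdge? : ∀ {n} (G : Graph n) (u v : Fin n) → Dec (u ≢ v × ¬ Adj G u v)
nonEdge? G u v = ¬? (u Fin.≟ v) ×-dec ¬? (adj? G u v)

nonEdges : ∀ {n} → Graph n → ℕ
nonEdges {n} G = ⅀ (λ ((u , v) : Fin n × Fin n) → ι (nonEdge? G u v))

nonEdges-bound : ∀ {n} (G : Graph n) → n * n ≤ nonEdges G + (n + arcs G)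
nonEdges-bound {n} G = begin
  n * n                                                         ≡⟨ sym all-pairs ⟩
  ⅀ (λ ((_ , _) : Fin n × Fin n) → 1)                           ≤⟨ ⅀-mono {A = Fin n × Fin n} pointwise ⟩
  ⅀ (λ ((u , v) : Fin n × Fin n) → ι (nonEdge? G u v) + (ι (v Fin.≟ u) + ι (adj? G u v)))
                                                                ≡⟨ ⅀-+ {A = Fin n × Fin n} _ _ ⟩
  nonEdges G + ⅀ (λ ((u , v) : Fin n × Fin n) → ι (v Fin.≟ u) + ι (adj? G u v))
                                                                ≡⟨ cong (nonEdges G +_) (⅀-+ {A = Fin n × Fin n} _ _) ⟩
  nonEdges G + (⅀ (λ ((u , v) : Fin n × Fin n) → ι (v Fin.≟ u)) + arcs G)
                                                                ≡⟨ cong (λ d → nonEdges G + (d + arcs G)) diagonal ⟩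
  nonEdges G + (n + arcs G)                                     ∎
  where
  open ≤-Reasoning
  all-pairs : ⅀ (λ ((_ , _) : Fin n × Fin n) → 1) ≡ n * n
  all-pairs = trans (⅀-× {A = Fin n} {B = Fin n} _)
    (trans (⅀-cong {A = Fin n} (λ _ → trans (⅀-const n 1) (*-identityʳ n))) (⅀-const n n))
  diagonal : ⅀ (λ ((u , v) : Fin n × Fin n) → ι (v Fin.≟ u)) ≡ n
  diagonal = trans (⅀-× {A = Fin n} {B = Fin n} _)
    (trans (⅀-cong {A = Fin n} ⅀-single) (trans (⅀-const n 1) (*-identityʳ n)))
  pointwise : ((u , v) : Fin n × Fin n) → 1 ≤ ι (nonEdge? G u v) + (ι (v Fin.≟ u) + ι (adj? G u v))
  pointwise (u , v) = cover (nonEdge? G u v) (v Fin.≟ u) (adj? G u v)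
    where
    cover : ∀ {P : Set} (p? : Dec (u ≢ v × ¬ P)) (e? : Dec (v ≡ u)) (d? : Dec P) → 1 ≤ ι p? + (ι e? + ι d?)
    cover (yes _) _       _       = s≤s z≤n
    cover (no _)  (yes _) _       = s≤s z≤n
    cover (no _)  (no _)  (yes _) = s≤s z≤n
    cover (no ¬p) (no v≢u) (no ¬d) = contradiction ((λ u≡v → v≢u (sym u≡v)) , ¬d) ¬p

-- Comparing consecutive edge numbers

module _ {n m N N′} (F : Family n m N) (F′ : Family n (suc m) N′) where

  coreArcs : ℕ
  coreArcs = ⅀ (λ j → inner (member F′ j) (core? (member F′ j)))

  -- A missing edge is added and remembered as an arc, which lies inside the core of the new graph.
  -- Graph and arc together determine the old graph.
  nonEdges≤coreArcs : ⅀ (λ i → nonEdges (member F i)) ≤ coreArcs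
  nonEdges≤coreArcs = subst₂ _≤_ (⅀-× {A = Fin N} {B = Fin n × Fin n} _) (⅀-× {A = Fin N′} {B = Fin n × Fin n} _)
    (⅀-injection
      (λ ((i , u , v) : Fin N × Fin n × Fin n) → nonEdge? (member F i) u v)
      (λ ((j , u , v) : Fin N′ × Fin n × Fin n) →
        let H = member F′ j in core? H u ×-dec core? H v ×-dec adj? H u v)
      (λ (i , u , v) (j , uv) → member F′ j ≡ toggle u v (member F i) × uv ≡ (u , v))
      (λ { {i , u , v} _ _ (eq , refl) (eq′ , refl) →
        cong (_, u , v) (member-injective F (toggle-injective u v (trans (sym eq) eq′))) })
      (λ { {i , u , v} (u≢v , ¬uv) → added u≢v ¬uv (index F′ (add-valid (member-valid F i) u≢v ¬uv)) }))
    where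
    added : ∀ {i u v} → u ≢ v → ¬ Adj (member F i) u v → (∃ λ j → member F′ j ≡ toggle u v (member F i)) →
            ∃ λ ((j , u′ , v′) : Fin N′ × Fin n × Fin n) →
              (InCore (member F′ j) u′ × InCore (member F′ j) v′ × Adj (member F′ j) u′ v′) ×
              (member F′ j ≡ toggle u v (member F i) × (u′ , v′) ≡ (u , v))
    added {i} {u} {v} u≢v ¬uv (j , eq) =
      let sG = isSimple (member-valid F i)
          (core-u , core-v) = added-edge⊆core sG (isConnected (member-valid F i)) u≢v ¬uv
      in (j , u , v) , (subst (λ H → InCore H u) (sym eq) core-u , subst (λ H → InCore H v) (sym eq) core-v ,
                        subst (λ H → Adj H u v) (sym eq) (add-new sG ¬uv (inj₁ (refl , refl)))) , eq , refl

  -- The diagonal and the arcs take up at most half of the n² ordered pairs, so at least half of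
  -- them are non-edges.
  count≤coreArcs : 2 * (n + 2 * m) ≤ n * n → N * (n * n) ≤ 2 * coreArcs
  count≤coreArcs sparse = begin
    N * (n * n)                              ≡⟨ sym (⅀-const N (n * n)) ⟩
    ⅀ (λ (_ : Fin N) → n * n)                ≤⟨ ⅀-mono half ⟩
    ⅀ (λ i → 2 * nonEdges (member F i))      ≡⟨ ⅀-*ˡ 2 (λ i → nonEdges (member F i)) ⟩
    2 * ⅀ (λ i → nonEdges (member F i))      ≤⟨ *-monoʳ-≤ 2 nonEdges≤coreArcs ⟩
    2 * coreArcs                             ∎
    where
    open ≤-Reasoning
    half : ∀ i → n * n ≤ 2 * nonEdges (member F i)
    half i = +-cancelʳ-≤ (n * n) _ _ (begin
      n * n + n * n            ≡⟨ cong (n * n +_) (sym (+-identityʳ (n * n))) ⟩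
      2 * (n * n)              ≤⟨ *-monoʳ-≤ 2 (nonEdges-bound G) ⟩
      2 * (nonEdges G + (n + arcs G)) ≡⟨ *-distribˡ-+ 2 (nonEdges G) _ ⟩
      2 * nonEdges G + 2 * (n + arcs G)
        ≡⟨ cong (λ e → 2 * nonEdges G + 2 * (n + e)) (trans (arcs-trueEntries G) (hasEdges (member-valid F i))) ⟩
      2 * nonEdges G + 2 * (n + 2 * m) ≤⟨ +-monoʳ-≤ (2 * nonEdges G) sparse ⟩
      2 * nonEdges G + n * n   ∎)
      where G = member F i

member-arcs : ∀ {n m N} (F : Family n m N) i → arcs (member F i) ≡ 2 * m
member-arcs F i = trans (arcs-trueEntries (member F i)) (hasEdges (member-valid F i))

-- Counting triangles

IsTriangle : ∀ {n} → Graph n → (a b c : Fin n) → Set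
IsTriangle G a b c = Adj G a b × Adj G b c × Adj G c a

isTriangle? : ∀ {n} (G : Graph n) a b c → Dec (IsTriangle G a b c)
isTriangle? G a b c = adj? G a b ×-dec adj? G b c ×-dec adj? G c a

triangles : ∀ {n} → Graph n → ℕ
triangles {n} G = ⅀ (λ ((a , b , c) : Fin n × Fin n × Fin n) → ι (isTriangle? G a b c))

⅀-arc-pairs : ∀ {n m N} (F : Family n m N) →
  ⅀ (λ ((j , (p , q) , (r , s)) : Fin N × (Fin n × Fin n) × (Fin n × Fin n)) →
       ι (adj? (member F j) p q ×-dec adj? (member F j) r s)) ≡ N * (2 * m * (2 * m))
⅀-arc-pairs {n} {m} {N} F = trans (⅀-× {A = Fin N} {B = (Fin n × Fin n) × (Fin n × Fin n)} _)
  (trans (⅀-cong (λ j → trans (⅀-× {A = Fin n × Fin n} {B = Fin n × Fin n} _)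
    (trans (⅀-cong {A = Fin n × Fin n} (λ (p , q) → ⅀-cong {A = Fin n × Fin n} (λ (r , s) →
             ι-× (adj? (member F j) p q) (adj? (member F j) r s))))
    (trans (⅀-separate {A = Fin n × Fin n} {B = Fin n × Fin n} _ _)
           (cong₂ _*_ (member-arcs F j) (member-arcs F j))))))
  (⅀-const N _))

module _ {n m N N₁ N₂} (F : Family n (2 + m) N) (F₁ : Family n (1 + m) N₁) (F₂ : Family n m N₂) where

  private
    -- A graph, an ordered triple of vertices and a vertex z to attach to. The free choice of z
    -- yields the factor n in `triangles-bound`.
    Token : Set
    Token = (Fin N × (Fin n × Fin n × Fin n)) × Fin n

    D : Fin N → (a b c : Fin n) → Graph n
    D i a b c = detach b c a (member F i)

    H₂ : Fin N → (a b c z : Fin n) → Graph n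
    H₂ i a b c z = toggle b z (D i a b c)

    H₃ : Fin N → (a b c z : Fin n) → Graph n
    H₃ i a b c z = toggle c z (detach c b a (member F i))

    T? : (t : Token) → let ((i , a , b , c) , z) = t in Dec (IsTriangle (member F i) a b c)
    T? ((i , a , b , c) , z) = isTriangle? (member F i) a b c

    -- Occurring in the family serves as a decidable form of validity, here and in the next two
    -- predicates.
    P₁? : (t : Token) → let ((i , a , b , c) , z) = t in
          Dec ((∃ λ j → member F₂ j ≡ D i a b c) × Adj (D i a b c) a c)
    P₁? ((i , a , b , c) , z) =
      Fin.any? (λ j → member F₂ j ≟ᴳ D i a b c) ×-dec adj? (D i a b c) a c

    P₂? : (t : Token) → let ((i , a , b , c) , z) = t in
          Dec ((∃ λ j → member F₁ j ≡ H₂ i a b c z) × Adj (H₂ i a b c z) b z × Adj (H₂ i a b c z) a c)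
    P₂? ((i , a , b , c) , z) = Fin.any? (λ j → member F₁ j ≟ᴳ H₂ i a b c z)
      ×-dec adj? (H₂ i a b c z) b z ×-dec adj? (H₂ i a b c z) a c

    P₃? : (t : Token) → let ((i , a , b , c) , z) = t in
          Dec ((∃ λ j → member F₁ j ≡ H₃ i a b c z) × Adj (H₃ i a b c z) c z × Adj (H₃ i a b c z) a b)
    P₃? ((i , a , b , c) , z) = Fin.any? (λ j → member F₁ j ≟ᴳ H₃ i a b c z)
      ×-dec adj? (H₃ i a b c z) c z ×-dec adj? (H₃ i a b c z) a b

    -- Either D is connected, or z lies on the side of a and b is moved, or z lies on the side of b
    -- and c is moved.
    cases : (t : Token) → ι (T? t) ≤ ι (P₁? t) + (ι (P₂? t) + ι (P₃? t))
    cases t@((i , a , b , c) , z) = ι-≤ one (T? t)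
      where
      one : IsTriangle (member F i) a b c → 1 ≤ ι (P₁? t) + (ι (P₂? t) + ι (P₃? t))
      one (ab , bc , ca) with Fin.any? (λ j → member F₂ j ≟ᴳ D i a b c)
      ... | yes j = ≤-trans (≤-reflexive (sym (ι-yes (j , Adj-sym B.detach-simple ca-D) (yes j ×-dec adj? (D i a b c) a c)))) (m≤m+n _ _)
        where open Triangle (member-valid F i) ab bc ca hiding (D)
      ... | no ¬j = two-cases (split (isConnected (member-valid F i) z b))
        where
        open Triangle (member-valid F i) ab bc ca hiding (D)
        sep = separated (¬j ∘ index F₂ ∘ detached-valid)
        two-cases : _ → 1 ≤ ι (P₂? t) + ι (P₃? t)
        two-cases (inj₂ w) = let (v , bz , ac) = reattach-b sep w in
          ≤-trans (≤-reflexive (sym (ι-yes (index F₁ v , bz , ac) (P₂? t)))) (m≤m+n _ _)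
        two-cases (inj₁ w) = let (v , cz , ab) = reattach-c sep w in
          ≤-trans (≤-reflexive (sym (ι-yes (index F₁ v , cz , ab) (P₃? t)))) (m≤n+m _ _)

    -- Only ac is recorded as an arc of the smaller graph; b and z remain arbitrary and cost n².
    bound₁ : ⅀ (λ t → ι (P₁? t)) ≤ N₂ * (2 * m) * (n * n)
    bound₁ = ≤-trans (⅀-injection P₁?
        (λ ((((j , a , c) , b) , z) : ((Fin N₂ × Fin n × Fin n) × Fin n) × Fin n) → adj? (member F₂ j) a c)
        (λ ((i , a , b , c) , z) (((j , a′ , c′) , b′) , z′) →
           member F₂ j ≡ D i a b c × (a′ , b′ , c′ , z′) ≡ (a , b , c , z))
        (λ { {(i , a , b , c) , z} _ _ (eq , refl) (eq′ , refl) → cong (λ i → (i , a , b , c) , z)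
           (member-injective F (detach-injective b c a (trans (sym eq) eq′))) })
        (λ { {(i , a , b , c) , z} ((j , eq) , ac) → (((j , a , c) , b) , z) ,
           subst (λ H → Adj H a c) (sym eq) ac , eq , refl }))
      (≤-reflexive (trans (⅀-× {A = (Fin N₂ × Fin n × Fin n) × Fin n} {B = Fin n} _)
      (trans (⅀-cong {A = (Fin N₂ × Fin n × Fin n) × Fin n} (λ _ → ⅀-const n _))
      (trans (⅀-× {A = Fin N₂ × Fin n × Fin n} {B = Fin n} _)
      (trans (⅀-cong {A = Fin N₂ × Fin n × Fin n} (λ _ → ⅀-const n _))
      (trans (⅀-× {A = Fin N₂} {B = Fin n × Fin n} _)
      (trans (⅀-cong (λ j → trans (⅀-*ˡ {A = Fin n × Fin n} n _) (cong (n *_)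
               (trans (⅀-*ˡ {A = Fin n × Fin n} n _) (cong (n *_) (member-arcs F₂ j))))))
      (trans (⅀-const N₂ _) (rearrange N₂ n (2 * m))))))))))
      where
      rearrange : ∀ N n e → N * (n * (n * e)) ≡ N * e * (n * n)
      rearrange = solve-∀

    bound₂ : ⅀ (λ t → ι (P₂? t)) ≤ N₁ * (2 * (1 + m) * (2 * (1 + m)))
    bound₂ = ≤-trans (⅀-injection P₂?
        (λ ((j , (p , q) , (r , s)) : Fin N₁ × (Fin n × Fin n) × (Fin n × Fin n)) →
           adj? (member F₁ j) p q ×-dec adj? (member F₁ j) r s)
        (λ ((i , a , b , c) , z) (j , (p , q) , (r , s)) →
           member F₁ j ≡ H₂ i a b c z × (p , q , r , s) ≡ (b , z , a , c))
        (λ { {(i , a , b , c) , z} _ _ (eq , refl) (eq′ , refl) → cong (λ i → (i , a , b , c) , z)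
           (member-injective F (detach-injective b c a (toggle-injective b z (trans (sym eq) eq′)))) })
        (λ { {(i , a , b , c) , z} ((j , eq) , bz , ac) → (j , (b , z) , (a , c)) ,
           subst (λ H → Adj H b z × Adj H a c) (sym eq) (bz , ac) , eq , refl }))
      (≤-reflexive (⅀-arc-pairs F₁))

    bound₃ : ⅀ (λ t → ι (P₃? t)) ≤ N₁ * (2 * (1 + m) * (2 * (1 + m)))
    bound₃ = ≤-trans (⅀-injection P₃?
        (λ ((j , (p , q) , (r , s)) : Fin N₁ × (Fin n × Fin n) × (Fin n × Fin n)) →
           adj? (member F₁ j) p q ×-dec adj? (member F₁ j) r s)
        (λ ((i , a , b , c) , z) (j , (p , q) , (r , s)) →
           member F₁ j ≡ H₃ i a b c z × (p , q , r , s) ≡ (c , z , a , b))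
        (λ { {(i , a , b , c) , z} _ _ (eq , refl) (eq′ , refl) → cong (λ i → (i , a , b , c) , z)
           (member-injective F (detach-injective c b a (toggle-injective c z (trans (sym eq) eq′)))) })
        (λ { {(i , a , b , c) , z} ((j , eq) , cz , ab) → (j , (c , z) , (a , b)) ,
           subst (λ H → Adj H c z × Adj H a b) (sym eq) (cz , ab) , eq , refl }))
      (≤-reflexive (⅀-arc-pairs F₁))

  triangles-bound : n * ⅀ (λ i → triangles (member F i)) ≤
                    N₂ * (2 * m) * (n * n) + 2 * (N₁ * (2 * (1 + m) * (2 * (1 + m))))
  triangles-bound = begin
    n * ⅀ (λ i → triangles (member F i))
      ≡⟨ cong (n *_) (sym (⅀-× {A = Fin N} {B = Fin n × Fin n × Fin n} _)) ⟩
    n * ⅀ (λ ((i , a , b , c) : Fin N × (Fin n × Fin n × Fin n)) → ι (isTriangle? (member F i) a b c))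
      ≡⟨ sym (⅀-*ˡ {A = Fin N × (Fin n × Fin n × Fin n)} n _) ⟩
    ⅀ (λ ((i , a , b , c) : Fin N × (Fin n × Fin n × Fin n)) → n * ι (isTriangle? (member F i) a b c))
      ≡⟨ sym (trans (⅀-× {A = Fin N × (Fin n × Fin n × Fin n)} {B = Fin n} _)
                    (⅀-cong {A = Fin N × (Fin n × Fin n × Fin n)} (λ _ → ⅀-const n _))) ⟩
    ⅀ (λ t → ι (T? t))
      ≤⟨ ⅀-mono cases ⟩
    ⅀ (λ t → ι (P₁? t) + (ι (P₂? t) + ι (P₃? t)))
      ≡⟨ trans (⅀-+ (λ t → ι (P₁? t)) _) (cong (⅀ (λ t → ι (P₁? t)) +_) (⅀-+ (λ t → ι (P₂? t)) _)) ⟩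
    ⅀ (λ t → ι (P₁? t)) + (⅀ (λ t → ι (P₂? t)) + ⅀ (λ t → ι (P₃? t)))
      ≤⟨ +-mono-≤ bound₁ (≤-trans (+-mono-≤ bound₂ bound₃) (≤-reflexive (cong (K +_) (sym (+-identityʳ K))))) ⟩
    N₂ * (2 * m) * (n * n) + 2 * K ∎
    where
    open ≤-Reasoning
    K = N₁ * (2 * (1 + m) * (2 * (1 + m)))

-- The second moment of the core size

2≤⅀ : ∀ {n} {P : Fin n → Set} (P? : ∀ i → Dec (P i)) {x y} → x ≢ y → P x → P y → 2 ≤ ⅀ (λ i → ι (P? i))
2≤⅀ P? {x} {y} x≢y px py = subst (_≤ ⅀ (λ i → ι (P? i)))
  (trans (⅀-+ (λ i → ι (i Fin.≟ x)) (λ i → ι (i Fin.≟ y))) (cong₂ _+_ (⅀-single x) (⅀-single y)))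
  (⅀-mono (λ i → ≤-trans (≤-reflexive (sym (ι-⊎ (λ { (refl , eq) → x≢y eq }) (i Fin.≟ x) (i Fin.≟ y))))
    (ι-mono [ (λ { refl → px }) , (λ { refl → py }) ]′ (i Fin.≟ x ⊎-dec i Fin.≟ y) (P? i))))

3≤⅀ : ∀ {n} {P : Fin n → Set} (P? : ∀ i → Dec (P i)) {x y z} → x ≢ y → x ≢ z → y ≢ z →
      P x → P y → P z → 3 ≤ ⅀ (λ i → ι (P? i))
3≤⅀ P? {x} {y} {z} x≢y x≢z y≢z px py pz = subst (_≤ ⅀ (λ i → ι (P? i)))
  (trans (⅀-+ (λ i → ι (i Fin.≟ x) + ι (i Fin.≟ y)) (λ i → ι (i Fin.≟ z)))
         (cong₂ _+_ (trans (⅀-+ (λ i → ι (i Fin.≟ x)) (λ i → ι (i Fin.≟ y))) (cong₂ _+_ (⅀-single x) (⅀-single y)))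
                    (⅀-single z)))
  (⅀-mono (λ i → ι-disjoint (λ { (refl , eq) → x≢y eq }) (λ { (refl , eq) → x≢z eq }) (λ { (refl , eq) → y≢z eq })
    (λ { refl → px }) (λ { refl → py }) (λ { refl → pz }) (i Fin.≟ x) (i Fin.≟ y) (i Fin.≟ z) (P? i)))

⅀-distinct-pairs : ∀ {n} {P : Fin n → Set} (P? : ∀ i → Dec (P i)) → let k = ⅀ (λ i → ι (P? i)) in
  ⅀ (λ ((x , y) : Fin n × Fin n) → ι (P? x ×-dec P? y ×-dec ¬? (y Fin.≟ x))) + k ≡ k * k
⅀-distinct-pairs {n} {P} P? = sym (begin
  k * k ≡⟨ sym (⅀-separate (λ x → ι (P? x)) (λ y → ι (P? y))) ⟩
  ⅀ (λ x → ⅀ (λ y → ι (P? x) * ι (P? y)))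
    ≡⟨ ⅀-cong (λ x → ⅀-cong (λ y → pointwise x y (P? x) (P? y) (y Fin.≟ x))) ⟩
  ⅀ (λ x → ⅀ (λ y → ι (P? x ×-dec P? y ×-dec ¬? (y Fin.≟ x)) + ι (P? x) * ι (y Fin.≟ x)))
    ≡⟨ ⅀-cong (λ x → trans (⅀-+ (λ y → ι (P? x ×-dec P? y ×-dec ¬? (y Fin.≟ x))) _)
         (cong (⅀ (λ y → ι (P? x ×-dec P? y ×-dec ¬? (y Fin.≟ x))) +_)
           (trans (⅀-*ˡ (ι (P? x)) (λ y → ι (y Fin.≟ x))) (trans (cong (ι (P? x) *_) (⅀-single x)) (*-identityʳ _))))) ⟩
  ⅀ (λ x → ⅀ (λ y → ι (P? x ×-dec P? y ×-dec ¬? (y Fin.≟ x))) + ι (P? x))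
    ≡⟨ ⅀-+ (λ x → ⅀ (λ y → ι (P? x ×-dec P? y ×-dec ¬? (y Fin.≟ x)))) (λ x → ι (P? x)) ⟩
  ⅀ (λ x → ⅀ (λ y → ι (P? x ×-dec P? y ×-dec ¬? (y Fin.≟ x)))) + k
    ≡⟨ cong (_+ k) (sym (⅀-× {A = Fin n} {B = Fin n} _)) ⟩
  ⅀ (λ ((x , y) : Fin n × Fin n) → ι (P? x ×-dec P? y ×-dec ¬? (y Fin.≟ x))) + k ∎)
  where
  open ≡-Reasoning
  k = ⅀ (λ i → ι (P? i))
  pointwise : ∀ x y (p? : Dec (P x)) (q? : Dec (P y)) (e? : Dec (y ≡ x)) →
              ι p? * ι q? ≡ ι (p? ×-dec q? ×-dec ¬? e?) + ι p? * ι e?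
  pointwise x y (no _)  q?      e?       = refl
  pointwise x y (yes _) (yes _) (yes _)  = refl
  pointwise x y (yes _) (yes _) (no _)   = refl
  pointwise x y (yes p) (no ¬q) (yes refl) = contradiction p ¬q
  pointwise x y (yes _) (no _)  (no _)   = refl

-- Core vertices of degree two

module _ {n} (G : Graph n) where

  -- As c itself must be in the core, `coreDegree` vanishes elsewhere and its sum over all vertices
  -- is the number of core arcs.
  CoreNb : Fin n → Fin n → Set
  CoreNb c x = InCore G c × InCore G x × Adj G c x

  coreNb? : ∀ c x → Dec (CoreNb c x)
  coreNb? c x = core? G c ×-dec core? G x ×-dec adj? G c x

  coreDegree : Fin n → ℕ
  coreDegree c = ⅀ (λ x → ι (coreNb? c x))

  NbPair : (c : Fin n) → Fin n × Fin n → Set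
  NbPair c (x , y) = (CoreNb c x × CoreNb c y × y ≢ x) × coreDegree c ≡ 2

  nbPair? : ∀ c xy → Dec (NbPair c xy)
  nbPair? c (x , y) = (coreNb? c x ×-dec coreNb? c y ×-dec ¬? (y Fin.≟ x)) ×-dec (coreDegree c ≟ 2)

  Pullable : (c : Fin n) → Fin n × Fin n → Set
  Pullable c (x , y) = NbPair c (x , y) × ¬ Adj G x y

  pullable? : ∀ c xy → Dec (Pullable c xy)
  pullable? c (x , y) = nbPair? c (x , y) ×-dec ¬? (adj? G x y)

  pullables : ℕ
  pullables = ⅀ (λ ((c , xy) : Fin n × (Fin n × Fin n)) → ι (pullable? c xy))

  coreSize : ℕ
  coreSize = size (core? G)

  ⅀-coreDegree : ⅀ coreDegree ≡ inner G (core? G)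
  ⅀-coreDegree = sym (⅀-× {A = Fin n} {B = Fin n} _)

  nbPairs : Fin n → ℕ
  nbPairs c = ⅀ (λ xy → ι (nbPair? c xy))

  nbPairs-two : ∀ {c} → coreDegree c ≡ 2 → nbPairs c ≡ 2
  nbPairs-two {c} d≡2 = +-cancelʳ-≡ (coreDegree c) _ _ (trans
    (cong (_+ coreDegree c) (⅀-cong {A = Fin n × Fin n} (λ (x , y) → ι-cong proj₁ (_, d≡2)
      (nbPair? c (x , y)) (coreNb? c x ×-dec coreNb? c y ×-dec ¬? (y Fin.≟ x)))))
    (trans (⅀-distinct-pairs (coreNb? c)) (trans (cong (λ d → d * d) d≡2) (cong (2 +_) (sym d≡2)))))

  nbPairs≤2 : ∀ c → nbPairs c ≤ 2
  nbPairs≤2 c = case coreDegree c ≟ 2 of λ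
    { (yes d≡2) → ≤-reflexive (nbPairs-two d≡2)
    ; (no d≢2)  → ≤-trans (≤-reflexive (⅀-zero {A = Fin n × Fin n} (λ xy → ι-no (d≢2 ∘ proj₂) (nbPair? c xy)))) z≤n }

  core-degree≥2 : ∀ {c} → InCore G c → 2 ≤ coreDegree c
  core-degree≥2 {c} core-c with core-two core-c
  ... | two p q p≢q (core-p , cp) (core-q , cq) = 2≤⅀ (coreNb? c) p≢q (core-c , core-p , cp) (core-c , core-q , cq)

  -- A core vertex of degree two contributes 2 + 2 · 2, through its two ordered neighbour pairs; one
  -- of degree at least three contributes at least 2 · 3.
  core-contribution : ∀ c → 6 * ι (core? G c) ≤ nbPairs c + 2 * coreDegree c
  core-contribution c = cases (core? G c) (coreDegree c ≟ 2)
    where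
    cases : (d : Dec (InCore G c)) → Dec (coreDegree c ≡ 2) → 6 * ι d ≤ nbPairs c + 2 * coreDegree c
    cases (no _)       _         = z≤n
    cases (yes _)      (yes d≡2) = ≤-reflexive (sym (cong₂ (λ a b → a + 2 * b) (nbPairs-two d≡2) d≡2))
    cases (yes core-c) (no d≢2)  =
      ≤-trans (*-monoʳ-≤ 2 (≤∧≢⇒< (core-degree≥2 core-c) (d≢2 ∘ sym))) (m≤n+m _ (nbPairs c))

  nbPairs-only : ∀ {c x y} → NbPair c (x , y) → ∀ {w} → InCore G w → Adj G c w → w ≡ x ⊎ w ≡ y
  nbPairs-only {c} {x} {y} ((nx@(core-c , _) , ny , y≢x) , d≡2) {w} core-w cw with w Fin.≟ x | w Fin.≟ y
  ... | yes w≡x | _       = inj₁ w≡x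
  ... | no _    | yes w≡y = inj₂ w≡y
  ... | no w≢x  | no w≢y  = contradiction
    (≤-trans (3≤⅀ (coreNb? c) (y≢x ∘ sym) (w≢x ∘ sym) (w≢y ∘ sym) nx ny (core-c , core-w , cw)) (≤-reflexive d≡2))
    (<⇒≱ ≤-refl)

module _ {n k} {G : Graph n} (vG : Valid (n + k) G) where

  private
    Triple : Set
    Triple = Fin n × (Fin n × Fin n)

  -- A neighbour pair that cannot be pulled is adjacent and forms a triangle with c.
  nbPairs-split : ⅀ (nbPairs G) ≤ pullables G + triangles G
  nbPairs-split = begin
    ⅀ (nbPairs G)
      ≡⟨ sym (⅀-× {A = Fin n} {B = Fin n × Fin n} _) ⟩
    ⅀ (λ ((c , xy) : Triple) → ι (nbPair? G c xy))
      ≤⟨ ⅀-mono {A = Triple} (λ (c , x , y) → pointwise c x y (adj? G x y)) ⟩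
    ⅀ (λ ((c , x , y) : Triple) → ι (pullable? G c (x , y)) + ι (isTriangle? G c x y))
      ≡⟨ ⅀-+ {A = Triple} _ _ ⟩
    pullables G + triangles G ∎
    where
    open ≤-Reasoning
    pointwise : ∀ c x y → Dec (Adj G x y) →
                ι (nbPair? G c (x , y)) ≤ ι (pullable? G c (x , y)) + ι (isTriangle? G c x y)
    pointwise c x y (no ¬xy) = ≤-trans
      (ι-mono (_, ¬xy) (nbPair? G c (x , y)) (pullable? G c (x , y))) (m≤m+n _ _)
    pointwise c x y (yes xy) = ≤-trans
      (ι-mono (λ { (((_ , _ , cx) , (_ , _ , cy) , _) , _) → cx , xy , Adj-sym (isSimple vG) cy })
        (nbPair? G c (x , y)) (isTriangle? G c x y)) (m≤n+m _ _)

  -- Summing `core-contribution` against the bound 2s + 2k on the core degrees shows that most core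
  -- vertices have degree two, up to triangles and an error in k.
  pullables-bound : 2 * coreSize G ≤ pullables G + triangles G + 4 * k
  pullables-bound = +-cancelʳ-≤ (4 * s) _ _ (begin
    2 * s + 4 * s
      ≡⟨ sym (*-distribʳ-+ s 2 4) ⟩
    6 * s
      ≡⟨ sym (⅀-*ˡ 6 (λ c → ι (core? G c))) ⟩
    ⅀ (λ c → 6 * ι (core? G c))
      ≤⟨ ⅀-mono (core-contribution G) ⟩
    ⅀ (λ c → nbPairs G c + 2 * coreDegree G c)
      ≡⟨ trans (⅀-+ (nbPairs G) _) (cong (⅀ (nbPairs G) +_) (trans (⅀-*ˡ 2 (coreDegree G)) (cong (2 *_) (⅀-coreDegree G)))) ⟩
    ⅀ (nbPairs G) + 2 * inner G (core? G)
      ≤⟨ +-mono-≤ nbPairs-split (*-monoʳ-≤ 2 (inner-bound vG (core? G))) ⟩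
    pullables G + triangles G + 2 * (2 * s + 2 * k)
      ≡⟨ rearrange (pullables G + triangles G) s k ⟩
    pullables G + triangles G + 4 * k + 4 * s ∎)
    where
    open ≤-Reasoning
    s = coreSize G
    rearrange : ∀ p s k → p + 2 * (2 * s + 2 * k) ≡ p + 4 * k + 4 * s
    rearrange = solve-∀

  hangs? : ∀ z c → Dec (Ext G z c)
  hangs? = ext? (isSimple vG) (isConnected vG)

  pulls : ℕ
  pulls = ⅀ (λ (((c , xy) , z) : Triple × Fin n) → ι (pullable? G c xy ×-dec ¬? (hangs? z c)))

  -- The excluded z cost at most 2n in total: each z hangs from at most one c, and that c has at
  -- most two neighbour pairs.
  pulls-bound : n * pullables G ≤ pulls + n * 2
  pulls-bound = begin
    n * pullables G
      ≡⟨ sym (⅀-*ˡ {A = Triple} n _) ⟩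
    ⅀ (λ ((c , xy) : Triple) → n * ι (pullable? G c xy))
      ≡⟨ sym (trans (⅀-× {A = Triple} {B = Fin n} _) (⅀-cong {A = Triple} (λ _ → ⅀-const n _))) ⟩
    ⅀ (λ (((c , xy) , z) : Triple × Fin n) → ι (pullable? G c xy))
      ≤⟨ ⅀-mono {A = Triple × Fin n} (λ ((c , xy) , z) → pointwise (pullable? G c xy) (nbPair? G c xy) proj₁ (hangs? z c)) ⟩
    ⅀ (λ (((c , xy) , z) : Triple × Fin n) →
         ι (pullable? G c xy ×-dec ¬? (hangs? z c)) + ι (hangs? z c) * ι (nbPair? G c xy))
      ≡⟨ ⅀-+ {A = Triple × Fin n} _ _ ⟩
    pulls + ⅀ (λ (((c , xy) , z) : Triple × Fin n) → ι (hangs? z c) * ι (nbPair? G c xy))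
      ≤⟨ +-monoʳ-≤ pulls hanging ⟩
    pulls + n * 2 ∎
    where
    open ≤-Reasoning
    pointwise : ∀ {P Q R : Set} (p? : Dec P) (q? : Dec Q) → (P → Q) → (r? : Dec R) →
                ι p? ≤ ι (p? ×-dec ¬? r?) + ι r? * ι q?
    pointwise (no _)  q?      h r?      = z≤n
    pointwise (yes _) q?      h (no _)  = s≤s z≤n
    pointwise (yes _) (yes _) h (yes _) = s≤s z≤n
    pointwise (yes p) (no ¬q) h (yes _) = contradiction (h p) ¬q
    hanging : ⅀ (λ (((c , xy) , z) : Triple × Fin n) → ι (hangs? z c) * ι (nbPair? G c xy)) ≤ n * 2
    hanging = begin
      ⅀ (λ (((c , xy) , z) : Triple × Fin n) → ι (hangs? z c) * ι (nbPair? G c xy))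
        ≡⟨ trans (⅀-× {A = Triple} {B = Fin n} _) (⅀-swap {A = Triple} {B = Fin n} _) ⟩
      ⅀ (λ z → ⅀ (λ ((c , xy) : Triple) → ι (hangs? z c) * ι (nbPair? G c xy)))
        ≡⟨ ⅀-cong (λ z → trans (⅀-× {A = Fin n} {B = Fin n × Fin n} _)
             (⅀-cong (λ c → ⅀-*ˡ (ι (hangs? z c)) (λ xy → ι (nbPair? G c xy))))) ⟩
      ⅀ (λ z → ⅀ (λ c → ι (hangs? z c) * nbPairs G c))
        ≤⟨ ⅀-mono (λ z → ⅀-mono (λ c → *-monoʳ-≤ (ι (hangs? z c)) (nbPairs≤2 G c))) ⟩
      ⅀ (λ z → ⅀ (λ c → ι (hangs? z c) * 2))
        ≡⟨ ⅀-cong (λ z → ⅀-*ʳ (λ c → ι (hangs? z c)) 2) ⟩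
      ⅀ (λ z → ⅀ (λ c → ι (hangs? z c)) * 2)
        ≤⟨ ⅀-bound n 2 (λ z → *-monoˡ-≤ 2 (⅀-atMostOne (hangs? z) (Ext-unique (isSimple vG)))) ⟩
      n * 2 ∎

-- The traces that pulls leave: a vertex c outside the core and an arc xy inside it.
outerPairs : ∀ {n} → Graph n → ℕ
outerPairs {n} G = ⅀ (λ ((c , x , y) : Fin n × (Fin n × Fin n)) →
  ι (¬? (core? G c) ×-dec (core? G x ×-dec core? G y ×-dec adj? G x y)))

-- The count is n - s times the number of core arcs, hence at most (n - s)(2s + 2k). The negative
-- terms stand on the left to avoid subtraction.
outerPairs-bound : ∀ {n k} {G : Graph n} → Valid (n + k) G → let s = coreSize G in
                   outerPairs G + (2 * (s * s) + 2 * k * s) ≤ 2 * n * s + 2 * k * n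
outerPairs-bound {n} {k} {G} vG = begin
  outerPairs G + (2 * (s * s) + 2 * k * s)
    ≡⟨ cong (_+ (2 * (s * s) + 2 * k * s)) (trans (⅀-× {A = Fin n} {B = Fin n × Fin n} _)
         (trans (⅀-cong {A = Fin n} (λ c → ⅀-cong {A = Fin n × Fin n} (λ (x , y) →
                   ι-× (¬? (core? G c)) (core? G x ×-dec core? G y ×-dec adj? G x y))))
                (⅀-separate {A = Fin n} {B = Fin n × Fin n} _ _))) ⟩
  t * inner G (core? G) + (2 * (s * s) + 2 * k * s)
    ≤⟨ +-monoˡ-≤ _ (*-monoʳ-≤ t (inner-bound vG (core? G))) ⟩
  t * (2 * s + 2 * k) + (2 * (s * s) + 2 * k * s)
    ≡⟨ rearrange t s k ⟩
  2 * (s + t) * s + 2 * k * (s + t)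
    ≡⟨ cong (λ n → 2 * n * s + 2 * k * n) s+t≡n ⟩
  2 * n * s + 2 * k * n ∎
  where
  open ≤-Reasoning
  s = coreSize G
  t = ⅀ (λ c → ι (¬? (core? G c)))
  s+t≡n : s + t ≡ n
  s+t≡n = trans (sym (⅀-+ (λ c → ι (core? G c)) _))
    (trans (⅀-cong (λ c → ι-¬ (core? G c))) (trans (⅀-const n 1) (*-identityʳ n)))
  rearrange : ∀ t s k → t * (2 * s + 2 * k) + (2 * (s * s) + 2 * k * s) ≡ 2 * (s + t) * s + 2 * k * (s + t)
  rearrange = solve-∀

-- Double count of the pulls

module _ {n k m N} (n+k≡2+m : n + k ≡ 2 + m) (F : Family n (n + k) N) where

  private
    Triple : Set
    Triple = Fin n × (Fin n × Fin n)

    P : (Fin N × (Triple × Fin n)) → Set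
    P (i , (c , xy) , z) = Pullable (member F i) c xy × ¬ Ext (member F i) z c

    Q : (Fin N × Triple) → Set
    Q (j , (c , x , y)) = let H = member F j in ¬ InCore H c × (InCore H x × InCore H y × Adj H x y)

    R : (Fin N × (Triple × Fin n)) → (Fin N × Triple) → Set
    R (i , (c , x , y) , z) (j , cxy) = member F j ≡ pull c x y z (member F i) × cxy ≡ (c , x , y)

    module Pulled {i c x y z} (p : P (i , (c , x , y) , z)) = Pull
      (subst (λ e → Valid e (member F i)) n+k≡2+m (member-valid F i))
      (proj₁ (proj₁ (proj₁ (proj₁ (proj₁ p)))))
      (proj₂ (proj₂ (proj₁ (proj₁ (proj₁ (proj₁ p))))))
      (proj₁ (proj₂ (proj₁ (proj₁ (proj₁ (proj₁ p))))))
      (proj₂ (proj₂ (proj₁ (proj₂ (proj₁ (proj₁ (proj₁ p)))))))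
      (proj₁ (proj₂ (proj₁ (proj₂ (proj₁ (proj₁ (proj₁ p)))))))
      (proj₂ (proj₂ (proj₁ (proj₁ (proj₁ p)))) ∘ sym)
      (nbPairs-only (member F i) (proj₁ (proj₁ p)))
      (proj₂ (proj₁ p))
      (proj₂ p)

    -- The trace gives c, x and y; the new graph then determines z by `z-unique`, and with all four
    -- vertices known the toggles can be undone.
    R-injective : ∀ {t t′ u} → P t → P t′ → R t u → R t′ u → t ≡ t′
    R-injective {i , (c , x , y) , z} {i′ , _ , z′} p p′ (eq , refl) (eq′ , refl) = helper z′≡z same
      where
      same : pull c x y z (member F i) ≡ pull c x y z′ (member F i′)
      same = trans (sym eq) eq′
      z′≡z : z′ ≡ z
      z′≡z = Pulled.z-unique p (subst (λ H → Adj H c z′) (sym same) (Pulled.cz-H p′))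
        (subst (λ H → Star (Avoiding H c) z′ x) (sym same) (Pulled.z-escapes p′))
      helper : z′ ≡ z → pull c x y z (member F i) ≡ pull c x y z′ (member F i′) →
               (i , (c , x , y) , z) ≡ (i′ , (c , x , y) , z′)
      helper refl eq = cong (λ i → i , (c , x , y) , z) (member-injective F (pull-injective c x y z eq))

    R-total : ∀ {t} → P t → ∃ λ u → Q u × R t u
    R-total {i , (c , x , y) , z} p =
      let (j , eq) = index F (subst (λ e → Valid e H) (sym n+k≡2+m) pull-valid)
      in (j , c , x , y) ,
         subst (λ H → ¬ InCore H c × (InCore H x × InCore H y × Adj H x y)) (sym eq)
           (c-removed , core-x-H , core-y-H , xy-H) ,
         eq , refl
      where open Pulled p

  pulls≤outerPairs : ⅀ (λ i → pulls (member-valid F i)) ≤ ⅀ (λ i → outerPairs (member F i))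
  pulls≤outerPairs = subst₂ _≤_ (⅀-× {A = Fin N} {B = Triple × Fin n} _) (⅀-× {A = Fin N} {B = Triple} _)
    (⅀-injection {P = P} {Q = Q}
      (λ (i , (c , xy) , z) → pullable? (member F i) c xy ×-dec ¬? (hangs? (member-valid F i) z c))
      (λ (j , (c , x , y)) → let H = member F j in
         ¬? (core? H c) ×-dec (core? H x ×-dec core? H y ×-dec adj? H x y))
      R R-injective R-total)

  private
    s t : Fin N → ℕ
    s i = coreSize (member F i)
    t i = triangles (member F i)

  -- Per graph there are at least about 2ns pulls and at most 2ns + 2kn - 2s² traces. Summed over
  -- all graphs the terms 2ns cancel and the squares remain. In 6k + 2, the traces give 2k,
  -- `pullables-bound` gives 4k and `pulls-bound` gives 2.
  second-moment : 2 * ⅀ (λ i → s i * s i) ≤ N * (n * (6 * k + 2)) + n * ⅀ t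
  second-moment = +-cancelʳ-≤ (⅀ (λ i → outerPairs (member F i)) + ⅀ (λ i → 2 * n * s i)) _ _ (begin
    2 * ⅀ (λ i → s i * s i) + (O + S)
      ≡⟨ cong (_+ (O + S)) (sym (⅀-*ˡ 2 (λ i → s i * s i))) ⟩
    ⅀ (λ i → 2 * (s i * s i)) + (O + S)
      ≡⟨ sym (trans (⅀-+ (λ i → 2 * (s i * s i)) _) (cong (⅀ (λ i → 2 * (s i * s i)) +_) (⅀-+ (λ i → outerPairs (member F i)) _))) ⟩
    ⅀ (λ i → 2 * (s i * s i) + (outerPairs (member F i) + 2 * n * s i))
      ≤⟨ ⅀-mono local ⟩
    ⅀ (λ i → n * (6 * k + 2) + (n * t i + (pulls (member-valid F i) + 2 * n * s i)))
      ≡⟨ trans (⅀-+ {A = Fin N} (λ i → n * (6 * k + 2)) _) (cong₂ _+_ (⅀-const N _)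
           (trans (⅀-+ (λ i → n * t i) _) (cong₂ _+_ (⅀-*ˡ n t) (⅀-+ (λ i → pulls (member-valid F i)) _)))) ⟩
    N * (n * (6 * k + 2)) + (n * ⅀ t + (⅀ (λ i → pulls (member-valid F i)) + S))
      ≤⟨ +-monoʳ-≤ (N * (n * (6 * k + 2))) (+-monoʳ-≤ (n * ⅀ t) (+-monoˡ-≤ S pulls≤outerPairs)) ⟩
    N * (n * (6 * k + 2)) + (n * ⅀ t + (O + S))
      ≡⟨ sym (+-assoc (N * (n * (6 * k + 2))) (n * ⅀ t) (O + S)) ⟩
    N * (n * (6 * k + 2)) + n * ⅀ t + (O + S) ∎)
    where
    open ≤-Reasoning
    O = ⅀ (λ i → outerPairs (member F i))
    S = ⅀ (λ i → 2 * n * s i)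
    local : ∀ i → 2 * (s i * s i) + (outerPairs (member F i) + 2 * n * s i) ≤
                  n * (6 * k + 2) + (n * t i + (pulls (member-valid F i) + 2 * n * s i))
    local i = begin
      2 * (a * a) + (o + 2 * n * a)          ≡⟨ e₁ (2 * (a * a)) o n a ⟩
      o + 2 * (a * a) + n * (2 * a)          ≤⟨ +-mono-≤ bound-o (*-monoʳ-≤ n (pullables-bound vG)) ⟩
      2 * n * a + 2 * k * n + n * (p + t i + 4 * k) ≡⟨ e₂ n a k p (t i) ⟩
      2 * n * a + n * (6 * k) + n * t i + n * p     ≤⟨ +-monoʳ-≤ _ (pulls-bound vG) ⟩
      2 * n * a + n * (6 * k) + n * t i + (q + n * 2) ≡⟨ e₃ n a k (t i) q ⟩
      n * (6 * k + 2) + (n * t i + (q + 2 * n * a)) ∎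
      where
      vG = member-valid F i
      a = s i
      o = outerPairs (member F i)
      p = pullables (member F i)
      q = pulls vG
      bound-o : o + 2 * (a * a) ≤ 2 * n * a + 2 * k * n
      bound-o = ≤-trans (+-monoʳ-≤ o (m≤m+n (2 * (a * a)) (2 * k * a))) (outerPairs-bound vG)
      e₁ : ∀ b o n a → b + (o + 2 * n * a) ≡ o + b + n * (2 * a)
      e₁ = solve-∀
      e₂ : ∀ n a k p t → 2 * n * a + 2 * k * n + n * (p + t + 4 * k) ≡ 2 * n * a + n * (6 * k) + n * t + n * p
      e₂ = solve-∀
      e₃ : ∀ n a k t q → 2 * n * a + n * (6 * k) + n * t + (q + n * 2) ≡ n * (6 * k + 2) + (n * t + (q + 2 * n * a))
      e₃ = solve-∀

-- Families from the counting functions, and existence of connected graphs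

module _ {c : ℕ → ℕ → ℕ} (isC : IsC c) where

  family : ∀ n m → Family n m (c n m)
  family n m = let (f , inj , val , surj) = isC n m in record
    { member           = f
    ; member-injective = inj
    ; member-valid     = λ i → let ((irr , symm) , edges , connected) = val i in valid (simple irr symm) edges connected
    ; index            = λ { {G} (valid (simple irr symm) edges connected) → surj G ((irr , symm) , edges , connected) }
    }

star : ∀ {n} → Fin n → Fin n → Bool
star zero    zero    = false
star zero    (suc _) = true
star (suc _) zero    = true
star (suc _) (suc _) = false

star-valid : ∀ p → Valid p (graph (star {suc p}))
star-valid p = valid sG edges (connected-via sG zero to-centre)
  where
  G = graph (star {suc p})
  adj : ∀ {i j} → star i j ≡ true → Adj G i j
  adj {i} {j} = trans (entry-graph star i j)
  sG : Simple G
  sG = simple (λ i → trans (entry-graph star i i) (loop i))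
              (λ i j → trans (entry-graph star i j) (trans (symm i j) (sym (entry-graph star j i))))
    where
    loop : ∀ (i : Fin (suc p)) → star i i ≡ false
    loop zero    = refl
    loop (suc _) = refl
    symm : ∀ (i j : Fin (suc p)) → star i j ≡ star j i
    symm zero    zero    = refl
    symm zero    (suc _) = refl
    symm (suc _) zero    = refl
    symm (suc _) (suc _) = refl
  to-centre : ∀ i → Walk G i zero
  to-centre zero    = here
  to-centre (suc i) = edge (adj {suc i} {zero} refl)
  edges : trueEntries G ≡ 2 * p
  edges = begin
    trueEntries G
      ≡⟨ trueEntries-⅀ G ⟩
    ⅀ (λ i → ⅀ (λ j → ι (adj? G i j)))
      ≡⟨ ⅀-cong {A = V} (λ i → ⅀-cong {A = V} (λ j → cong (λ b → ι (b Bool.≟ true)) (entry-graph star i j))) ⟩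
    ⅀ (λ i → ⅀ (λ j → σ i j))
      ≡⟨ ⅀-suc (λ i → ⅀ (σ i)) ⟩
    ⅀ (σ zero) + ⅀ (λ i → ⅀ (σ (suc i)))
      ≡⟨ cong₂ _+_ (trans (⅀-suc (σ zero)) (⅀-const p 1))
                   (⅀-cong (λ i → trans (⅀-suc (σ (suc i))) (cong suc (⅀-zero {A = Fin p} (λ _ → refl))))) ⟩
    p * 1 + ⅀ (λ (_ : Fin p) → 1)
      ≡⟨ cong₂ _+_ (*-identityʳ p) (trans (⅀-const p 1) (trans (*-identityʳ p) (sym (+-identityʳ p)))) ⟩
    2 * p ∎
    where
    open ≡-Reasoning
    V = Fin (suc p)
    σ : V → V → ℕ
    σ i j = ι (star i j Bool.≟ true)

coreArcs≤ : ∀ {n m N N′} (F : Family n m N) (F′ : Family n (suc m) N′) → coreArcs F F′ ≤ N′ * (2 * suc m)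
coreArcs≤ {N′ = N′} F F′ = ⅀-bound N′ _ (λ j →
  ≤-trans (inner≤arcs (member F′ j) (core? (member F′ j))) (≤-reflexive (member-arcs F′ j)))

module _ {c : ℕ → ℕ → ℕ} (isC : IsC c) where

  -- Induction on the surplus j, starting from a star. If no graph had one more edge, there would be
  -- no core arcs, and `count≤coreArcs` would bound a positive number by 0.
  count-positive : ∀ p j → 2 * (suc p + 2 * (p + j)) ≤ suc p * suc p → 0 < c (suc p) (p + j)
  count-positive p zero    _      = inhabited (proj₁ (index (family isC (suc p) (p + 0))
    (subst (λ m → Valid m (graph (star {suc p}))) (sym (+-identityʳ p)) (star-valid p))))
    where
    inhabited : ∀ {N} → Fin N → 0 < N
    inhabited {suc _} _ = s≤s z≤n
  count-positive p (suc j) sparse = subst (λ m → 0 < c (suc p) m) (sym (+-suc p j)) (positive _ refl)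
    where
    sparse′ : 2 * (suc p + 2 * (p + j)) ≤ suc p * suc p
    sparse′ = ≤-trans (*-monoʳ-≤ 2 (+-monoʳ-≤ (suc p) (*-monoʳ-≤ 2 (+-monoʳ-≤ p (n≤1+n j))))) sparse
    F = family isC (suc p) (p + j)
    F′ = family isC (suc p) (suc (p + j))
    positive : ∀ N → N ≡ c (suc p) (suc (p + j)) → 0 < N
    positive (suc _) _  = s≤s z≤n
    positive zero    eq = contradiction
      (≤-trans (*-mono-≤ (count-positive p j sparse′) (s≤s (z≤n {p + p * suc p})))
      (≤-trans (count≤coreArcs F F′ sparse′)
      (≤-trans (*-monoʳ-≤ 2 (coreArcs≤ F F′)) (≤-reflexive (cong (λ N → 2 * (N * (2 * suc (p + j)))) (sym eq))))))
      (λ ())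

-- Final estimates

-- Whichever of n and Ds is larger, the product n · Ds is at most its square. This stands in for the
-- Cauchy-Schwarz inequality when passing from second to first moments.
square-split : ∀ D n s → D * n * s ≤ n * n + D * D * (s * s)
square-split D n s with ≤-total (D * s) n
... | inj₁ Ds≤n = ≤-trans (≤-reflexive (e D n s)) (≤-trans (*-monoʳ-≤ n Ds≤n) (m≤m+n (n * n) _))
  where
  e : ∀ D n s → D * n * s ≡ n * (D * s)
  e = solve-∀
... | inj₂ n≤Ds = ≤-trans (≤-reflexive (e D n s))
    (≤-trans (*-monoˡ-≤ (D * s) n≤Ds) (≤-trans (≤-reflexive (e′ D s)) (m≤n+m _ (n * n))))
  where
  e : ∀ D n s → D * n * s ≡ n * (D * s)
  e = solve-∀
  e′ : ∀ D s → D * s * (D * s) ≡ D * D * (s * s)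
  e′ = solve-∀

module _ {c : ℕ → ℕ → ℕ} (isC : IsC c) (n′ k : ℕ) where

  private
    -- With n = n′ + 2, the edge number n + k computes to 2 + m, which leaves room to delete two
    -- edges.
    n m : ℕ
    n = suc (suc n′)
    m = n′ + k

    F = family isC n (2 + m)
    F₁ = family isC n (1 + m)
    F₂ = family isC n m

    N N₁ N₂ e T S S² : ℕ
    N = c n (2 + m)
    N₁ = c n (1 + m)
    N₂ = c n m
    e = 2 * (1 + m)
    T = ⅀ (λ i → triangles (member F i))
    S = ⅀ (λ i → coreSize (member F i))
    S² = ⅀ (λ i → coreSize (member F i) * coreSize (member F i))

  module _ (n≥10 : 10 ≤ n) (k≥1 : 1 ≤ k) (k≤n : k ≤ n) where

    open ≤-Reasoning

    private
      1+m≤2n : 1 + m ≤ 2 * n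
      1+m≤2n = begin
        1 + m      ≤⟨ n≤1+n (1 + m) ⟩
        n + k      ≤⟨ +-monoʳ-≤ n k≤n ⟩
        n + n      ≡⟨ cong (n +_) (sym (+-identityʳ n)) ⟩
        2 * n      ∎

      sparse : ∀ j → j ≤ 2 * n → 2 * (n + 2 * j) ≤ n * n
      sparse j j≤ = begin
        2 * (n + 2 * j)       ≤⟨ *-monoʳ-≤ 2 (+-monoʳ-≤ n (*-monoʳ-≤ 2 j≤)) ⟩
        2 * (n + 2 * (2 * n)) ≡⟨ ten n ⟩
        10 * n                ≤⟨ *-monoˡ-≤ n n≥10 ⟩
        n * n                 ∎
        where
        ten : ∀ n → 2 * (n + 2 * (2 * n)) ≡ 10 * n
        ten = solve-∀

      e≤4n : e ≤ 4 * n
      e≤4n = ≤-trans (*-monoʳ-≤ 2 1+m≤2n) (≤-reflexive (sym (*-assoc 2 2 n)))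

      -- Adding an edge turns n² N₂ into at most 2 N₁ e, so both terms of `triangles-bound` become
      -- multiples of N₁ e², and e is at most 4n.
      triangles≤N₁ : n * T ≤ 64 * (N₁ * (n * n))
      triangles≤N₁ = begin
        n * T
          ≤⟨ triangles-bound F F₁ F₂ ⟩
        N₂ * (2 * m) * (n * n) + 2 * (N₁ * (e * e))
          ≡⟨ cong (_+ 2 * (N₁ * (e * e))) (e₁ N₂ (2 * m) (n * n)) ⟩
        2 * m * (N₂ * (n * n)) + 2 * (N₁ * (e * e))
          ≤⟨ +-monoˡ-≤ _ (*-mono-≤ (*-monoʳ-≤ 2 (n≤1+n m)) (count≤coreArcs F₂ F₁ (sparse m (≤-trans (n≤1+n m) 1+m≤2n)))) ⟩
        e * (2 * coreArcs F₂ F₁) + 2 * (N₁ * (e * e))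
          ≤⟨ +-monoˡ-≤ _ (*-monoʳ-≤ e (*-monoʳ-≤ 2 (coreArcs≤ F₂ F₁))) ⟩
        e * (2 * (N₁ * e)) + 2 * (N₁ * (e * e))
          ≡⟨ e₂ e N₁ ⟩
        4 * (N₁ * (e * e))
          ≤⟨ *-monoʳ-≤ 4 (*-monoʳ-≤ N₁ (*-mono-≤ e≤4n e≤4n)) ⟩
        4 * (N₁ * (4 * n * (4 * n)))
          ≡⟨ e₃ N₁ n ⟩
        64 * (N₁ * (n * n)) ∎
        where
        e₁ : ∀ N m n → N * m * n ≡ m * (N * n)
        e₁ = solve-∀
        e₂ : ∀ e N → e * (2 * (N * e)) + 2 * (N * (e * e)) ≡ 4 * (N * (e * e))
        e₂ = solve-∀
        e₃ : ∀ N n → 4 * (N * (4 * n * (4 * n))) ≡ 64 * (N * (n * n))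
        e₃ = solve-∀

      -- One more edge is added, but now the core arcs are bounded by 2s + 2k instead of by all
      -- arcs. This keeps the core size visible, so that a small average core forces few triangles.
      triangles≤core : n * T ≤ 256 * (S + N * k)
      triangles≤core = begin
        n * T                       ≤⟨ triangles≤N₁ ⟩
        64 * (N₁ * (n * n))         ≤⟨ *-monoʳ-≤ 64 (count≤coreArcs F₁ F (sparse (1 + m) 1+m≤2n)) ⟩
        64 * (2 * coreArcs F₁ F)    ≤⟨ *-monoʳ-≤ 64 (*-monoʳ-≤ 2 (⅀-mono (λ i → inner-bound (member-valid F i) (core? (member F i))))) ⟩
        64 * (2 * ⅀ (λ i → 2 * coreSize (member F i) + 2 * k))
          ≡⟨ cong (λ x → 64 * (2 * x)) (trans (⅀-+ (λ i → 2 * coreSize (member F i)) (λ _ → 2 * k))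
               (cong₂ _+_ (⅀-*ˡ 2 (λ i → coreSize (member F i))) (⅀-const N (2 * k)))) ⟩
        64 * (2 * (2 * S + N * (2 * k))) ≡⟨ e₁ S N k ⟩
        256 * (S + N * k)           ∎
        where
        e₁ : ∀ S N k → 64 * (2 * (2 * S + N * (2 * k))) ≡ 256 * (S + N * k)
        e₁ = solve-∀

      S≤Nn : S ≤ N * n
      S≤Nn = ⅀-bound N n (λ i → size≤ (core? (member F i)))

      -- The trivial bound s ≤ n suffices here, as it already makes n T at most 512 N n; 514 is 512
      -- + 2.
      S²-bound : S² ≤ 260 * k * (N * n)
      S²-bound = *-cancelˡ-≤ 2 (begin
        2 * S²
          ≤⟨ second-moment refl F ⟩
        N * (n * (6 * k + 2)) + n * T
          ≤⟨ +-monoʳ-≤ (N * (n * (6 * k + 2))) (≤-trans triangles≤core (*-monoʳ-≤ 256 (+-mono-≤ S≤Nn (*-monoʳ-≤ N k≤n)))) ⟩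
        N * (n * (6 * k + 2)) + 256 * (N * n + N * n)
          ≡⟨ e₁ N n k ⟩
        (6 * k + 514 * 1) * (N * n)
          ≤⟨ *-monoˡ-≤ (N * n) (+-monoʳ-≤ (6 * k) (*-monoʳ-≤ 514 k≥1)) ⟩
        (6 * k + 514 * k) * (N * n)
          ≡⟨ e₂ k (N * n) ⟩
        2 * (260 * k * (N * n)) ∎)
        where
        e₁ : ∀ N n k → N * (n * (6 * k + 2)) + 256 * (N * n + N * n) ≡ (6 * k + 514 * 1) * (N * n)
        e₁ = solve-∀
        e₂ : ∀ k x → (6 * k + 514 * k) * x ≡ 2 * (260 * k * x)
        e₂ = solve-∀

      -- `square-split` is summed over all graphs; smallness of 260 D² k makes the second-moment
      -- term at most N n².
      S-bound : ∀ D → 260 * (D * D) * k ≤ n → D * S ≤ 2 * (N * n)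
      S-bound D small = *-cancelʳ-≤ (D * S) (2 * (N * n)) n (begin
        D * S * n
          ≡⟨ e₁ D S n ⟩
        D * n * S
          ≡⟨ sym (⅀-*ˡ (D * n) (λ i → coreSize (member F i))) ⟩
        ⅀ (λ i → D * n * coreSize (member F i))
          ≤⟨ ⅀-mono (λ i → square-split D n (coreSize (member F i))) ⟩
        ⅀ (λ i → n * n + D * D * (coreSize (member F i) * coreSize (member F i)))
          ≡⟨ trans (⅀-+ {A = Fin N} (λ _ → n * n) _) (cong₂ _+_ (⅀-const N (n * n)) (⅀-*ˡ (D * D) (λ i → coreSize (member F i) * coreSize (member F i)))) ⟩
        N * (n * n) + D * D * S²
          ≤⟨ +-monoʳ-≤ (N * (n * n)) (*-monoʳ-≤ (D * D) S²-bound) ⟩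
        N * (n * n) + D * D * (260 * k * (N * n))
          ≡⟨ cong (N * (n * n) +_) (e₂ (D * D) k (N * n)) ⟩
        N * (n * n) + 260 * (D * D) * k * (N * n)
          ≤⟨ +-monoʳ-≤ (N * (n * n)) (*-monoˡ-≤ (N * n) small) ⟩
        N * (n * n) + n * (N * n)
          ≡⟨ e₃ N n ⟩
        2 * (N * n) * n ∎)
        where
        e₁ : ∀ D S n → D * S * n ≡ D * n * S
        e₁ = solve-∀
        e₂ : ∀ D k x → D * (260 * k * x) ≡ 260 * D * k * x
        e₂ = solve-∀
        e₃ : ∀ N n → N * (n * n) + n * (N * n) ≡ 2 * (N * n) * n
        e₃ = solve-∀

    -- The factor 1024 is 4 · 256. After multiplication by 4n, the core sizes use two and the term N
    -- k one of the four available shares of N n.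
    few-triangles : ∀ d → let D = 1024 * d in 260 * (D * D) * k ≤ n → D * k ≤ n → d * T ≤ N
    few-triangles d small Dk≤n = *-cancelˡ-≤ (4 * n) (begin
      4 * n * (d * T)                ≡⟨ e₁ n d T ⟩
      4 * d * (n * T)                ≤⟨ *-monoʳ-≤ (4 * d) triangles≤core ⟩
      4 * d * (256 * (S + N * k))    ≡⟨ e₂ d S N k ⟩
      1024 * d * S + N * (1024 * d * k) ≤⟨ +-mono-≤ (S-bound (1024 * d) small) (*-monoʳ-≤ N Dk≤n) ⟩
      2 * (N * n) + N * n            ≤⟨ m≤m+n _ (N * n) ⟩
      2 * (N * n) + N * n + N * n    ≡⟨ e₃ N n ⟩
      4 * n * N                      ∎)
      where
      e₁ : ∀ n d T → 4 * n * (d * T) ≡ 4 * d * (n * T)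
      e₁ = solve-∀
      e₂ : ∀ d S N k → 4 * d * (256 * (S + N * k)) ≡ 1024 * d * S + N * (1024 * d * k)
      e₂ = solve-∀
      e₃ : ∀ N n → 2 * (N * n) + N * n + N * n ≡ 4 * n * N
      e₃ = solve-∀

    graphs-exist : 0 < N
    graphs-exist = subst (λ j → 0 < c n j) (+-suc (suc n′) k)
      (count-positive isC (suc n′) (suc k) (sparse (suc n′ + suc k) (begin
        suc n′ + suc k ≡⟨ +-suc (suc n′) k ⟩
        n + k          ≤⟨ +-monoʳ-≤ n k≤n ⟩
        n + n          ≡⟨ cong (n +_) (sym (+-identityʳ n)) ⟩
        2 * n          ∎)))

  -- Each graph either is triangle-free or contributes at least one ordered triple to T.
  not-triangle-free≤triangles : ∀ {cC3 : ℕ → ℕ → ℕ} → IsCC3 cC3 → N ∸ cC3 n (2 + m) ≤ T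
  not-triangle-free≤triangles {cC3} isCC3 = m≤n+o⇒m∸n≤o N N₃ (begin
    N
      ≡⟨ sym (trans (⅀-const N 1) (*-identityʳ N)) ⟩
    ⅀ (λ (_ : Fin N) → 1)
      ≤⟨ ⅀-mono (λ i → dichotomy i (triangle? i)) ⟩
    ⅀ (λ i → ι (¬? (triangle? i)) + triangles (member F i))
      ≡⟨ ⅀-+ (λ i → ι (¬? (triangle? i))) (λ i → triangles (member F i)) ⟩
    ⅀ (λ i → ι (¬? (triangle? i))) + T
      ≤⟨ +-monoˡ-≤ T triangle-free≤ ⟩
    N₃ + T ∎)
    where
    open ≤-Reasoning
    N₃ = cC3 n (2 + m)
    HasTriangle : Graph n → Set
    HasTriangle G = ∃ λ a → ∃ λ b → ∃ λ c → IsTriangle G a b c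
    triangle? : ∀ i → Dec (HasTriangle (member F i))
    triangle? i = Fin.any? λ a → Fin.any? λ b → Fin.any? λ c → isTriangle? (member F i) a b c
    dichotomy : ∀ i (d : Dec (HasTriangle (member F i))) → 1 ≤ ι (¬? d) + triangles (member F i)
    dichotomy i (no _) = s≤s z≤n
    dichotomy i (yes (a , b , c , t)) = subst (_≤ triangles (member F i)) (ι-yes t (isTriangle? (member F i) a b c))
      (⅀-≥term (λ ((a , b , c) : Fin n × Fin n × Fin n) → ι (isTriangle? (member F i) a b c)) (a , b , c))
    triangle-free≤ : ⅀ (λ i → ι (¬? (triangle? i))) ≤ N₃
    triangle-free≤ = let (f , _ , _ , surj) = isCC3 n (2 + m) in
      ≤-trans (⅀-injection (λ i → ¬? (triangle? i)) (λ (_ : Fin N₃) → yes tt) (λ i j → f j ≡ member F i)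
        (λ _ _ eq eq′ → member-injective F (trans (sym eq) eq′))
        (λ {i} ¬t → let (valid (simple irr symm) edges connected) = member-valid F i
                        (j , eq) = surj (member F i) ((irr , symm) , edges , connected ,
                                     λ a b c ab bc ca → ¬t (a , b , c , ab , bc , ca))
                    in j , tt , eq))
      (≤-reflexive (trans (⅀-const N₃ 1) (*-identityʳ N₃)))

-- From the estimates to the limit

theorem29 : (c cC3 : ℕ → ℕ → ℕ) → IsC c → IsCC3 cC3 → (k : ℕ → ℕ)
    → (∀ M → Eventually (λ n → M ≤ k n))
    → (∀ d → Eventually (λ n → d * (k n ^ 3) ≤ n))
    → ∀ d → Eventually (λ n → 0 < c n (n + k n) × d * (c n (n + k n) ∸ cC3 n (n + k n)) ≤ c n (n + k n))
theorem29 c cC3 isC isCC3 k k→∞ k³=o[n] d = 10 + (n₁ + n₂) , eventually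
  where
  D K n₁ n₂ : ℕ
  D = 1024 * d
  -- The three summands are the multiples of k that must stay below n. As 1 ≤ k gives k ≤ k³, one
  -- application of the growth hypothesis with K covers all of them.
  K = 260 * (D * D) + D + 1
  n₁ = proj₁ (k→∞ 1)
  n₂ = proj₁ (k³=o[n] K)
  eventually : ∀ n → 10 + (n₁ + n₂) ≤ n →
    0 < c n (n + k n) × d * (c n (n + k n) ∸ cC3 n (n + k n)) ≤ c n (n + k n)
  eventually zero          ()
  eventually (suc zero)    (s≤s ())
  eventually n@(suc (suc n′)) large =
    graphs-exist isC n′ (k n) n≥10 k≥1 k≤n ,
    ≤-trans (*-monoʳ-≤ d (not-triangle-free≤triangles isC n′ (k n) {cC3} isCC3))
            (few-triangles isC n′ (k n) n≥10 k≥1 k≤n d small Dk≤n)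
    where
    open ≤-Reasoning
    n≥10 : 10 ≤ n
    n≥10 = ≤-trans (m≤m+n 10 (n₁ + n₂)) large
    k≥1 : 1 ≤ k n
    k≥1 = proj₂ (k→∞ 1) n (≤-trans (≤-trans (m≤m+n n₁ n₂) (m≤n+m (n₁ + n₂) 10)) large)
    k≤k³ : k n ≤ k n ^ 3
    k≤k³ = begin
      k n         ≡⟨ sym (*-identityʳ (k n)) ⟩
      k n * 1     ≤⟨ *-monoʳ-≤ (k n) (*-mono-≤ k≥1 (*-mono-≤ k≥1 (≤-refl {1}))) ⟩
      k n ^ 3     ∎
    total : 260 * (D * D) * k n + D * k n + k n ≤ n
    total = begin
      260 * (D * D) * k n + D * k n + k n   ≡⟨ expand (260 * (D * D)) D (k n) ⟩
      K * k n                               ≤⟨ *-monoʳ-≤ K k≤k³ ⟩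
      K * k n ^ 3                           ≤⟨ proj₂ (k³=o[n] K) n (≤-trans (≤-trans (m≤n+m n₂ n₁) (m≤n+m (n₁ + n₂) 10)) large) ⟩
      n                                     ∎
      where
      expand : ∀ A D k → A * k + D * k + k ≡ (A + D + 1) * k
      expand = solve-∀
    k≤n : k n ≤ n
    k≤n = ≤-trans (m≤n+m (k n) _) total
    Dk≤n : D * k n ≤ n
    Dk≤n = ≤-trans (≤-trans (m≤n+m (D * k n) _) (m≤m+n _ (k n))) total
    small : 260 * (D * D) * k n ≤ n
    small = ≤-trans (≤-trans (m≤m+n _ (D * k n)) (m≤m+n _ (k n))) total
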